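{- Let $a,b,s,h$ be positive integers with $s\ge 2$, $a,b\ge 2$ and $r=a+b\ge 5$. Then for every $C_0>0$ there exist $n_0>0$ and $C_1>0$ such that the following holds. If $n>n_0$ and $\mathcal H$ is an $n$-vertex $r$-uniform hypergraph on vertex set $[n]$ not containing the bush $\mathcal B_{s,h}(a,b)$ and with \[ |\mathcal H| > (s-1)\binom{n}{r-1} - C_0 n^{r-2}, \] then there are $s-1$ vertices in $[n]$ each of which is contained in at least $\binom{n}{r-1}-C_1 n^{r-2}$ edges of $\mathcal H$.
   Context: An $r$-uniform hypergraph is identified with its edge set. For positive integers $a,b,s,h$ with $s\ge2$ and $r=a+b$, the bush $\mathcal B_{s,h}(a,b)$ is the $r$-graph constructed as follows: take pairwise disjoint sets $A$ with $|A|=a$, $B_1,\dots,B_s$ with $|B_i|=b$, and $A_{i,j}$ ($i\in[s]$, $j\in[h]$) with $|A_{i,j}|=a$; its edges are $A\cup B_i$ for $i\in[s]$ and $B_i\cup A_{i,j}$ for $i\in[s]$, $j\in[h]$. "$\mathcal H$ contains" it means $\mathcal H$ has a subfamily isomorphic to it. -}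

module Defs where

open import Data.Nat using (ℕ)
open import Data.Fin using (Fin)
open import Data.Fin.Subset using (Subset; ∣_∣) renaming (_∈_ to _∈ₛ_)
open import Data.Fin.Subset.Properties using (_∈?_)
open import Data.List using (List; length; filter)
open import Data.List.Membership.Propositional using (_∈_)
open import Data.List.Relation.Unary.All using (All)
open import Data.List.Relation.Unary.Unique.Propositional using (Unique)
open import Data.Product using (Σ; ∃; _×_)
open import Data.Unit using (⊤)
open import Data.Empty using (⊥)
open import Relation.Binary.PropositionalEquality using (_≡_)
open import Function using (Injective)

record Hypergraph (n r : ℕ) : Set where
  field
    edges   : List (Subset n)
    unique  : Unique edges
    uniform : All (λ e → ∣ e ∣ ≡ r) edges
open Hypergraph public

size : ∀ {n r} → Hypergraph n r → ℕ
size H = length (edges H)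

degree : ∀ {n r} → Hypergraph n r → Fin n → ℕ
degree H v = length (filter (λ e → v ∈? e) (edges H))

-- Vertex set of the bush B_{s,h}(a,b):
--   vA x        : the x-th vertex of A            (|A| = a)
--   vB i y      : the y-th vertex of B_i          (|B_i| = b, i ∈ [s])
--   vAij i j x  : the x-th vertex of A_{i,j}      (|A_{i,j}| = a, i ∈ [s], j ∈ [h])
data BushV (a b s h : ℕ) : Set where
  vA   : Fin a → BushV a b s h
  vB   : Fin s → Fin b → BushV a b s h
  vAij : Fin s → Fin h → Fin a → BushV a b s h

InEdge₁ : ∀ {a b s h} → Fin s → BushV a b s h → Set
InEdge₁ i (vA _)       = ⊤
InEdge₁ i (vB i' _)    = i' ≡ i
InEdge₁ i (vAij _ _ _) = ⊥

InEdge₂ : ∀ {a b s h} → Fin s → Fin h → BushV a b s h → Set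
InEdge₂ i j (vA _)         = ⊥
InEdge₂ i j (vB i' _)      = i' ≡ i
InEdge₂ i j (vAij i' j' _) = (i' ≡ i) × (j' ≡ j)

ImageIsEdge : ∀ {n r} {V : Set} → Hypergraph n r → (V → Fin n) → (V → Set) → Set
ImageIsEdge {n} H φ P =
  Σ (Subset n) λ e → (e ∈ edges H) ×
    (∀ v → (v ∈ₛ e → ∃ λ x → P x × (φ x ≡ v)) × ((∃ λ x → P x × (φ x ≡ v)) → v ∈ₛ e))

ContainsBush : ∀ {n r} → (a b s h : ℕ) → Hypergraph n r → Set
ContainsBush {n} a b s h H =
  Σ (BushV a b s h → Fin n) λ φ → Injective _≡_ _≡_ φ ×
    ((i : Fin s) → ImageIsEdge H φ (InEdge₁ i)) ×
    ((i : Fin s) (j : Fin h) → ImageIsEdge H φ (InEdge₂ i j))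

{-# OPTIONS --safe #-}
module Submission where

open import Defs
open import Data.Bool as Bool using (Bool; true; false; if_then_else_)
open import Data.Empty using (⊥; ⊥-elim)
open import Data.Fin using (Fin; zero; suc; fromℕ<; inject≤; punchIn; punchOut; combine; remQuot; funToFin; finToFun)
import Data.Fin.Properties as Fin
open import Data.Fin.Subset using (Subset; ∣_∣; inside; outside; ⁅_⁆; ∁; _∪_; _∩_)
  renaming (_∈_ to _∈ₛ_; _∉_ to _∉ₛ_; _⊆_ to _⊆ₛ_; ⊥ to ⊥ₛ)
open import Data.Fin.Subset.Properties
  using (_∈?_; anySubset?; ⊆-antisym; p⊂q⇒∣p∣<∣q∣; ∣p∣≤n; x∈⁅x⁆; x∈⁅y⁆⇒x≡y; ∣⁅x⁆∣≡1; ∉⊥; ∣⊥∣≡0; ∪-comm;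
         q⊆p∪q; x∈p∪q⁻; x∈p∪q⁺; x∈p∩q⁺; x∈p∩q⁻; p∩q⊆p; p∩q⊆q; x∈∁p⇒x∉p; x∉p⇒x∈∁p)
open import Data.List as List
  using (List; []; _∷_; _++_; length; filter; map; concatMap; lookup; allFin; cartesianProduct; cartesianProductWith)
open import Data.List.Membership.Propositional using (_∈_; find; lose)
open import Data.List.Membership.Propositional.Properties
  using (∈-map⁺; ∈-map⁻; ∈-++⁻; ∈-filter⁺; ∈-filter⁻; ∈-allFin; ∈-lookup; ∈-tabulate⁺; ∈-concatMap⁺; ∈-length;
         ∈-cartesianProduct⁺; ∈-cartesianProduct⁻; ∈-cartesianProductWith⁺)
open import Data.List.Properties
  using (length-map; length-++; length-tabulate; length-filter; filter-notAll; filter-all; map-++; map-∘)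
import Data.List.Relation.Binary.Sublist.Propositional.Properties as Sublist
open import Data.List.Relation.Unary.All as All using (All; []; _∷_)
open import Data.List.Relation.Unary.AllPairs as AllPairs using (AllPairs)
import Data.List.Relation.Unary.AllPairs.Properties as AllPairs
open import Data.List.Relation.Unary.Any as Any using (here; there; index)
open import Data.List.Relation.Unary.Any.Properties using (lookup-index)
open import Data.List.Relation.Unary.Unique.Propositional using (Unique; []; _∷_)
import Data.List.Relation.Unary.Unique.Propositional.Properties as Unique
open import Data.Nat as ℕ using (ℕ; zero; suc; _+_; _*_; _∸_; _^_; _≤_; _<_; _≥_; z≤n; s≤s; s≤s⁻¹; _≤?_)
open import Data.Nat.Combinatorics using (_C_; nCk+nC[k+1]≡[n+1]C[k+1]; k>n⇒nCk≡0)
open import Data.Nat.ListAction using (sum)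
open import Data.Nat.ListAction.Properties using (sum-++)
open import Data.Nat.Properties
open import Data.Nat.Solver using (module +-*-Solver)
open import Data.Product using (Σ; ∃; ∃₂; _×_; _,_; proj₁; proj₂)
open import Data.Product.Properties using (≡-dec)
open import Data.Sum using (_⊎_; inj₁; inj₂; [_,_]′)
open import Data.Unit using (tt)
open import Data.Vec as Vec using (Vec; []; _∷_; here; there)
import Data.Vec.Properties as Vec
open import Function using (Injective; _∘_; id)
open import Relation.Binary using (DecidableEquality)
open import Relation.Binary.PropositionalEquality
open import Relation.Nullary using (¬_; Dec; yes; no; does; contradiction; ¬?; _×-dec_; _⊎-dec_; _→-dec_)
open import Relation.Nullary.Decidable using (decidable-stable; dec-true)
open import Relation.Unary using (Decidable)
open import Algebra.Properties.CommutativeSemigroup +-commutativeSemigroup using (interchange)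

-- Only sunflower-like information is needed.  For a family of edges listed as tuples and a set P of
-- positions, P is flexible if an edge can be changed outside P so as to avoid any bounded set of
-- vertices.  If P is not flexible at an edge, then a positive proportion of the edges through its
-- P-part share one further vertex; repeating this, every family of more than C n^(r-2) edges contains
-- one in which each P is flexible or determines a further position, and which still has more than
-- n^(r-2) edges.  There, P is flexible unless exactly one forced position (one determined by all the
-- others) lies outside P.  If the number of forced positions is not one, the positions split into an
-- a-set and a b-set which are both flexible (this uses a, b ≥ 2 and r ≥ 5), and a bush is found
-- greedily.  So the forced position is unique; call its vertex the centre of the edge.  Hence all but
-- O(n^(r-2)) edges of H have a centre.
--
-- For an (r-1)-set S let W(S) be the set of w such that S ∪ {w} has centre w.  Centres of edges
-- through a common a-set A can be completed greedily to a bush, so at most s-1 vertices outside A are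
-- centres over A.  Thus |W(S)| ≤ s-1, the lower bound on |H| forces equality for all but O(n^(r-2))
-- sets S, and W(S) = W(S') whenever two such sets share an a-set.  Changing one coordinate at a time
-- shows that W(S) is the same set W for all but O(n^(r-2)) sets S, and each w ∈ W has the required degree.

private variable
  n m k : ℕ

-- Subsets of Fin n

_≟ₛ_ : DecidableEquality (Subset n)
_≟ₛ_ = Vec.≡-dec Bool._≟_

select : {P : Fin n → Set} → Decidable P → Subset n
select P? = Vec.tabulate (does ∘ P?)

∈-select⁺ : {P : Fin n → Set} (P? : Decidable P) {x : Fin n} → P x → x ∈ₛ select P?
∈-select⁺ P? {x} px = Vec.lookup⇒[]= x _ (trans (Vec.lookup∘tabulate _ x) (dec-true (P? x) px))

∈-select⁻ : {P : Fin n → Set} (P? : Decidable P) {x : Fin n} → x ∈ₛ select P? → P x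
∈-select⁻ P? {x} x∈ with P? x | trans (sym (Vec.lookup∘tabulate (does ∘ P?) x)) (Vec.[]=⇒lookup x∈)
... | yes px | _ = px

enum : (p : Subset n) → Fin ∣ p ∣ → Fin n
enum (inside  ∷ p) zero    = zero
enum (inside  ∷ p) (suc i) = suc (enum p i)
enum (outside ∷ p) i       = suc (enum p i)

enum-∈ : (p : Subset n) (i : Fin ∣ p ∣) → enum p i ∈ₛ p
enum-∈ (inside  ∷ p) zero    = here
enum-∈ (inside  ∷ p) (suc i) = there (enum-∈ p i)
enum-∈ (outside ∷ p) i       = there (enum-∈ p i)

enum-surjective : (p : Subset n) {x : Fin n} → x ∈ₛ p → ∃ λ i → enum p i ≡ x
enum-surjective (inside ∷ p) here = zero , refl
enum-surjective (inside ∷ p) (there x∈) with enum-surjective p x∈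
... | i , refl = suc i , refl
enum-surjective (outside ∷ p) (there x∈) with enum-surjective p x∈
... | i , refl = i , refl

enum-injective : (p : Subset n) → Injective _≡_ _≡_ (enum p)
enum-injective (inside  ∷ p) {zero}  {zero}  _  = refl
enum-injective (inside  ∷ p) {suc i} {suc j} eq = cong suc (enum-injective p (Fin.suc-injective eq))
enum-injective (outside ∷ p) eq = enum-injective p (Fin.suc-injective eq)

enumAs : (p : Subset n) → ∣ p ∣ ≡ k → Fin k → Fin n
enumAs p refl = enum p

enumAs-∈ : (p : Subset n) (eq : ∣ p ∣ ≡ k) (i : Fin k) → enumAs p eq i ∈ₛ p
enumAs-∈ p refl = enum-∈ p

enumAs-surjective : (p : Subset n) (eq : ∣ p ∣ ≡ k) {x : Fin n} → x ∈ₛ p → ∃ λ i → enumAs p eq i ≡ x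
enumAs-surjective p refl = enum-surjective p

enumAs-injective : (p : Subset n) (eq : ∣ p ∣ ≡ k) → Injective _≡_ _≡_ (enumAs p eq)
enumAs-injective p refl = enum-injective p

image : (Fin k → Fin n) → Subset n
image f = select (λ v → Fin.any? (λ i → f i Fin.≟ v))

∈-image⁺ : (f : Fin k → Fin n) (i : Fin k) → f i ∈ₛ image f
∈-image⁺ f i = ∈-select⁺ (λ v → Fin.any? (λ i → f i Fin.≟ v)) (i , refl)

∈-image⁻ : (f : Fin k → Fin n) {v : Fin n} → v ∈ₛ image f → ∃ λ i → f i ≡ v
∈-image⁻ f = ∈-select⁻ (λ v → Fin.any? (λ i → f i Fin.≟ v))

injective⇒≤∣∣ : (p : Subset n) (f : Fin k → Fin n) → Injective _≡_ _≡_ f → (∀ i → f i ∈ₛ p) → k ≤ ∣ p ∣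
injective⇒≤∣∣ p f inj f∈ = Fin.injective⇒≤ {f = λ i → proj₁ (enum-surjective p (f∈ i))}
  λ {i} {j} eq → inj (trans (sym (proj₂ (enum-surjective p (f∈ i))))
                     (trans (cong (enum p) eq) (proj₂ (enum-surjective p (f∈ j)))))

∣image∣ : (f : Fin k → Fin n) → Injective _≡_ _≡_ f → ∣ image f ∣ ≡ k
∣image∣ {k} f inj = ≤-antisym
  (Fin.injective⇒≤ {f = λ i → proj₁ (pre i)}
    λ {i} {j} eq → enum-injective (image f)
      (trans (sym (proj₂ (pre i))) (trans (cong f eq) (proj₂ (pre j)))))
  (injective⇒≤∣∣ (image f) f inj (∈-image⁺ f))
  where
  pre : (i : Fin ∣ image f ∣) → ∃ λ j → f j ≡ enum (image f) i
  pre i = ∈-image⁻ f (enum-∈ (image f) i)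

∣p∪q∣≤∣p∣+∣q∣ : (p q : Subset n) → ∣ p ∪ q ∣ ≤ ∣ p ∣ + ∣ q ∣
∣p∪q∣≤∣p∣+∣q∣ []            []            = z≤n
∣p∪q∣≤∣p∣+∣q∣ (inside  ∷ p) (inside  ∷ q) = s≤s (≤-trans (∣p∪q∣≤∣p∣+∣q∣ p q) (+-monoʳ-≤ ∣ p ∣ (n≤1+n _)))
∣p∪q∣≤∣p∣+∣q∣ (inside  ∷ p) (outside ∷ q) = s≤s (∣p∪q∣≤∣p∣+∣q∣ p q)
∣p∪q∣≤∣p∣+∣q∣ (outside ∷ p) (inside  ∷ q) = ≤-trans (s≤s (∣p∪q∣≤∣p∣+∣q∣ p q)) (≤-reflexive (sym (+-suc ∣ p ∣ ∣ q ∣)))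
∣p∪q∣≤∣p∣+∣q∣ (outside ∷ p) (outside ∷ q) = ∣p∪q∣≤∣p∣+∣q∣ p q

∣p∩q∣+∣p∩∁q∣≡∣p∣ : (p q : Subset n) → ∣ p ∩ q ∣ + ∣ p ∩ ∁ q ∣ ≡ ∣ p ∣
∣p∩q∣+∣p∩∁q∣≡∣p∣ []            []            = refl
∣p∩q∣+∣p∩∁q∣≡∣p∣ (inside  ∷ p) (inside  ∷ q) = cong suc (∣p∩q∣+∣p∩∁q∣≡∣p∣ p q)
∣p∩q∣+∣p∩∁q∣≡∣p∣ (inside  ∷ p) (outside ∷ q) = trans (+-suc _ _) (cong suc (∣p∩q∣+∣p∩∁q∣≡∣p∣ p q))
∣p∩q∣+∣p∩∁q∣≡∣p∣ (outside ∷ p) (_ ∷ q)       = ∣p∩q∣+∣p∩∁q∣≡∣p∣ p q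

q⊆p⇒∣q∣+∣p∩∁q∣≡∣p∣ : {p q : Subset n} → q ⊆ₛ p → ∣ q ∣ + ∣ p ∩ ∁ q ∣ ≡ ∣ p ∣
q⊆p⇒∣q∣+∣p∩∁q∣≡∣p∣ {p = p} {q} q⊆p = trans
  (cong (λ z → ∣ z ∣ + ∣ p ∩ ∁ q ∣) (⊆-antisym (λ x∈q → x∈p∩q⁺ (q⊆p x∈q , x∈q)) (p∩q⊆q p q)))
  (∣p∩q∣+∣p∩∁q∣≡∣p∣ p q)

∈-minus⁺ : {p q : Subset n} {x : Fin n} → x ∈ₛ p → x ∉ₛ q → x ∈ₛ p ∩ ∁ q
∈-minus⁺ x∈p x∉q = x∈p∩q⁺ (x∈p , x∉p⇒x∈∁p x∉q)

∈-minus⁻ : {p q : Subset n} {x : Fin n} → x ∈ₛ p ∩ ∁ q → x ∈ₛ p × x ∉ₛ q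
∈-minus⁻ {p = p} {q} x∈ = proj₁ (x∈p∩q⁻ p (∁ q) x∈) , x∈∁p⇒x∉p (proj₂ (x∈p∩q⁻ p (∁ q) x∈))

∪-minus : {p q : Subset n} → q ⊆ₛ p → q ∪ (p ∩ ∁ q) ≡ p
∪-minus {p = p} {q} q⊆p = ⊆-antisym
  (λ x∈ → [ q⊆p , p∩q⊆p p (∁ q) ]′ (x∈p∪q⁻ q (p ∩ ∁ q) x∈))
  λ {x} x∈p → x∈p∪q⁺ (case x x∈p)
  where
  case : ∀ x → x ∈ₛ p → x ∈ₛ q ⊎ x ∈ₛ p ∩ ∁ q
  case x x∈p with x ∈? q
  ... | yes x∈q = inj₁ x∈q
  ... | no  x∉q = inj₂ (∈-minus⁺ x∈p x∉q)

∣p∣≢1⇒another : (p : Subset n) → ∣ p ∣ ≢ 1 → {x : Fin n} → x ∈ₛ p → ∃ λ y → y ∈ₛ p × y ≢ x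
∣p∣≢1⇒another p ≢1 {x} x∈p with Fin.any? (λ y → (y ∈? p) ×-dec ¬? (y Fin.≟ x))
... | yes found = found
... | no none = ⊥-elim (≢1 (trans (cong ∣_∣ p≡⁅x⁆) (∣⁅x⁆∣≡1 x)))
  where
  p≡⁅x⁆ : p ≡ ⁅ x ⁆
  p≡⁅x⁆ = ⊆-antisym
    (λ {y} y∈p → subst (_∈ₛ ⁅ x ⁆) (sym (decidable-stable (y Fin.≟ x) (λ y≢x → none (y , y∈p , y≢x)))) (x∈⁅x⁆ x))
    (λ y∈ → subst (_∈ₛ p) (sym (x∈⁅y⁆⇒x≡y x y∈)) x∈p)

drop-suc : {i m : ℕ} → i + suc m ≤ suc n → i + m ≤ n
drop-suc {i = i} {m} le = s≤s⁻¹ (≤-trans (≤-reflexive (sym (+-suc i m))) le)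

-- Greedy from the front: a position of `N` is taken while `i` lasts, a position outside `N` while
-- `j` lasts. The last bound gives the complement of `N` room for `j` positions.
∃-split : (N : Subset n) (i j : ℕ) → i ≤ ∣ N ∣ → i + j ≤ n → j + ∣ N ∣ ≤ n →
          ∃ λ P → ∣ P ∣ ≡ i + j × ∣ N ∩ P ∣ ≡ i
∃-split [] zero zero _ _ _ = [] , refl , refl
∃-split (inside ∷ N) zero j _ _ j≤ with ∃-split N zero j z≤n (≤-trans (m≤m+n j ∣ N ∣) (drop-suc j≤)) (drop-suc j≤)
... | P , eq , eq′ = outside ∷ P , eq , eq′
∃-split (inside ∷ N) (suc i) j i≤ ij≤ j≤ with ∃-split N i j (s≤s⁻¹ i≤) (s≤s⁻¹ ij≤) (drop-suc j≤)
... | P , eq , eq′ = inside ∷ P , cong suc eq , cong suc eq′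
∃-split (outside ∷ N) i zero i≤ _ _
  with ∃-split N i zero i≤ (≤-trans (≤-reflexive (+-identityʳ i)) (≤-trans i≤ (∣p∣≤n N))) (∣p∣≤n N)
... | P , eq , eq′ = outside ∷ P , eq , eq′
∃-split (outside ∷ N) i (suc j) i≤ ij≤ j≤ with ∃-split N i j i≤ (drop-suc ij≤) (s≤s⁻¹ j≤)
... | P , eq , eq′ = inside ∷ P , trans (cong suc eq) (sym (+-suc i j)) , eq′

-- Lists and finite sums

lookup-injective : {A : Set} {xs : List A} → Unique xs → ∀ {i j} → lookup xs i ≡ lookup xs j → i ≡ j
lookup-injective (_ ∷ _)   {zero}  {zero}  _  = refl
lookup-injective (x∉ ∷ _) {zero}  {suc j} eq = contradiction eq (All.lookup x∉ (∈-lookup j))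
lookup-injective (x∉ ∷ _) {suc i} {zero}  eq = contradiction (sym eq) (All.lookup x∉ (∈-lookup i))
lookup-injective (_ ∷ u)   {suc i} {suc j} eq = cong suc (lookup-injective u eq)

unique⊆⇒length≤ : {A : Set} {xs ys : List A} → Unique xs → (∀ {x} → x ∈ xs → x ∈ ys) → length xs ≤ length ys
unique⊆⇒length≤ {xs = xs} {ys} u xs⊆ys = Fin.injective⇒≤ {f = λ i → index (xs⊆ys (∈-lookup i))}
  λ {i} {j} eq → lookup-injective u
    (trans (lookup-index (xs⊆ys (∈-lookup {xs = xs} i)))
    (trans (cong (lookup ys) eq) (sym (lookup-index (xs⊆ys (∈-lookup {xs = xs} j))))))

length-filter-¬ : {A : Set} {P : A → Set} (P? : Decidable P) (xs : List A) →
                  length (filter P? xs) + length (filter (¬? ∘ P?) xs) ≡ length xs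
length-filter-¬ P? [] = refl
length-filter-¬ P? (x ∷ xs) with ih ← length-filter-¬ P? xs | does (P? x)
... | true  = cong suc ih
... | false = trans (+-suc _ _) (cong suc ih)

-- Splitting off the elements related to the first tag leaves a list covered by the remaining tags;
-- the larger of the two fibres obtained pays for both pieces. The product form avoids division.
pigeonhole : {A T : Set} {R : A → T → Set} (R? : ∀ x t → Dec (R x t)) (ts : List T) (xs : List A) →
             (∀ {x} → x ∈ xs → ∃ λ t → t ∈ ts × R x t) → 0 < length xs →
             ∃ λ t → t ∈ ts × length xs ≤ length ts * length (filter (λ x → R? x t) xs)
pigeonhole R? [] (x ∷ xs) covered _ with covered (here refl)
... | _ , () , _
pigeonhole {A} {T} {R} R? (t ∷ ts) xs covered 0< with 0 ℕ.<? length (filter (¬? ∘ λ x → R? x t) xs)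
... | no ≮ = t , here refl , (begin
  length xs                          ≡⟨ length-filter-¬ (λ x → R? x t) xs ⟨
  length A₁ + length A₂              ≤⟨ +-monoʳ-≤ (length A₁) (≤-trans (≮⇒≥ ≮) z≤n) ⟩
  length A₁ + length ts * length A₁  ∎)
  where
  open ≤-Reasoning
  A₁ = filter (λ x → R? x t) xs
  A₂ = filter (¬? ∘ λ x → R? x t) xs
... | yes 0<A₂ = result
  where
  open ≤-Reasoning
  A₁ = filter (λ x → R? x t) xs
  A₂ = filter (¬? ∘ λ x → R? x t) xs
  covered′ : ∀ {x} → x ∈ A₂ → ∃ λ t → t ∈ ts × R x t
  covered′ x∈ with ∈-filter⁻ (¬? ∘ λ x → R? x t) {xs = xs} x∈
  ... | x∈xs , ¬Rxt with covered x∈xs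
  ... | .t , here refl , Rxt = contradiction Rxt ¬Rxt
  ... | t′ , there t′∈ , Rxt′ = t′ , t′∈ , Rxt′
  mono : ∀ t′ → length (filter (λ x → R? x t′) A₂) ≤ length (filter (λ x → R? x t′) xs)
  mono t′ = Sublist.length-mono-≤
    (Sublist.filter⁺ (λ x → R? x t′) (λ x → R? x t′) (λ { refl → id }) (Sublist.filter-⊆ (¬? ∘ λ x → R? x t) xs))
  split : ∀ N → length A₁ ≤ N → length A₂ ≤ length ts * N → length xs ≤ N + length ts * N
  split N le₁ le₂ = ≤-trans (≤-reflexive (sym (length-filter-¬ (λ x → R? x t) xs))) (+-mono-≤ le₁ le₂)
  result : ∃ λ t′ → t′ ∈ t ∷ ts × length xs ≤ suc (length ts) * length (filter (λ x → R? x t′) xs)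
  result with pigeonhole R? ts A₂ covered′ 0<A₂
  ... | t′ , t′∈ , le with ≤-total (length A₁) (length (filter (λ x → R? x t′) xs))
  ... | inj₁ A₁≤ = t′ , there t′∈ , split _ A₁≤ (≤-trans le (*-monoʳ-≤ (length ts) (mono t′)))
  ... | inj₂ ≤A₁ = t , here refl , split _ ≤-refl (≤-trans le (*-monoʳ-≤ (length ts) (≤-trans (mono t′) ≤A₁)))

∑ : {A : Set} → List A → (A → ℕ) → ℕ
∑ xs g = sum (map g xs)

ind : {P : Set} → Dec P → ℕ
ind P? = if does P? then 1 else 0

ind-yes : {P : Set} (P? : Dec P) → P → ind P? ≡ 1
ind-yes (yes _) _ = refl
ind-yes (no ¬p) p = contradiction p ¬p

ind≤ : {P : Set} (P? : Dec P) {m : ℕ} → (P → 1 ≤ m) → ind P? ≤ m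
ind≤ (yes p) f = f p
ind≤ (no _)  _ = z≤n

module _ {A : Set} where

  ∑-mono : (xs : List A) {f g : A → ℕ} → (∀ {x} → x ∈ xs → f x ≤ g x) → ∑ xs f ≤ ∑ xs g
  ∑-mono []       _   = z≤n
  ∑-mono (x ∷ xs) f≤g = +-mono-≤ (f≤g (here refl)) (∑-mono xs (f≤g ∘ there))

  ∑-cong : (xs : List A) {f g : A → ℕ} → (∀ x → f x ≡ g x) → ∑ xs f ≡ ∑ xs g
  ∑-cong []       _   = refl
  ∑-cong (x ∷ xs) f≡g = cong₂ _+_ (f≡g x) (∑-cong xs f≡g)

  ∑-+ : (xs : List A) (f g : A → ℕ) → ∑ xs (λ x → f x + g x) ≡ ∑ xs f + ∑ xs g
  ∑-+ []       f g = refl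
  ∑-+ (x ∷ xs) f g = trans (cong (f x + g x +_) (∑-+ xs f g)) (interchange (f x) (g x) (∑ xs f) (∑ xs g))

  ∑-const : (xs : List A) (c : ℕ) → ∑ xs (λ _ → c) ≡ length xs * c
  ∑-const []       c = refl
  ∑-const (x ∷ xs) c = cong (c +_) (∑-const xs c)

  ∑-* : (xs : List A) (f : A → ℕ) (c : ℕ) → ∑ xs (λ x → f x * c) ≡ ∑ xs f * c
  ∑-* []       f c = refl
  ∑-* (x ∷ xs) f c = trans (cong (f x * c +_) (∑-* xs f c)) (sym (*-distribʳ-+ c (f x) (∑ xs f)))

  ∑-ind : {P : A → Set} (P? : Decidable P) (xs : List A) → ∑ xs (ind ∘ P?) ≡ length (filter P? xs)
  ∑-ind P? []       = refl
  ∑-ind P? (x ∷ xs) with ih ← ∑-ind P? xs | does (P? x)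
  ... | true  = cong suc ih
  ... | false = ih

  ∑-swap : {B : Set} (xs : List A) (ys : List B) (f : A → B → ℕ) →
           ∑ xs (λ x → ∑ ys (f x)) ≡ ∑ ys (λ y → ∑ xs (λ x → f x y))
  ∑-swap xs []       f = trans (∑-const xs 0) (*-zeroʳ (length xs))
  ∑-swap xs (y ∷ ys) f = trans (∑-+ xs (λ x → f x y) (λ x → ∑ ys (f x))) (cong (∑ xs (λ x → f x y) +_) (∑-swap xs ys f))

  min≤average : (xs : List A) (g : A → ℕ) → 0 < length xs → ∃ λ x → x ∈ xs × length xs * g x ≤ ∑ xs g
  min≤average (x ∷ []) g _ = x , here refl , ≤-refl
  min≤average (x ∷ xs@(_ ∷ _)) g _ with min≤average xs g (s≤s z≤n)
  ... | z , z∈ , le with ≤-total (g x) (g z)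
  ... | inj₁ x≤z = x , here refl , +-monoʳ-≤ (g x) (≤-trans (*-monoʳ-≤ (length xs) x≤z) le)
  ... | inj₂ z≤x = z , there z∈ , +-mono-≤ z≤x le

∑-++ : {A : Set} (xs ys : List A) (g : A → ℕ) → ∑ (xs ++ ys) g ≡ ∑ xs g + ∑ ys g
∑-++ xs ys g = trans (cong sum (map-++ g xs ys)) (sum-++ (map g xs) (map g ys))

∑-cartesianProductWith : {A B D : Set} (f : A → B → D) (xs : List A) (ys : List B) (g : D → ℕ) →
                         ∑ (cartesianProductWith f xs ys) g ≡ ∑ xs (λ x → ∑ ys (λ y → g (f x y)))
∑-cartesianProductWith f []       ys g = refl
∑-cartesianProductWith f (x ∷ xs) ys g = trans (∑-++ (map (f x) ys) _ g)
  (cong₂ _+_ (cong sum (sym (map-∘ ys))) (∑-cartesianProductWith f xs ys g))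

length-cartesianProductWith : {A B D : Set} (f : A → B → D) (xs : List A) (ys : List B) →
                              length (cartesianProductWith f xs ys) ≡ length xs * length ys
length-cartesianProductWith f []       ys = refl
length-cartesianProductWith f (x ∷ xs) ys = trans (length-++ (map (f x) ys))
  (cong₂ _+_ (length-map (f x) ys) (length-cartesianProductWith f xs ys))

-- Enumeration of words and of subsets

words : {A : Set} → List A → (k : ℕ) → List (Vec A k)
words xs zero    = [] ∷ []
words xs (suc k) = cartesianProductWith _∷_ xs (words xs k)

module _ {A : Set} {xs : List A} where

  ∈-words : (∀ x → x ∈ xs) → (w : Vec A k) → w ∈ words xs k
  ∈-words all∈ []      = here refl
  ∈-words all∈ (x ∷ w) = ∈-cartesianProductWith⁺ _∷_ (all∈ x) (∈-words all∈ w)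

  words-unique : Unique xs → ∀ k → Unique (words xs k)
  words-unique u zero    = [] ∷ []
  words-unique u (suc k) = Unique.cartesianProductWith⁺ _∷_ Vec.∷-injective u (words-unique u k)

  length-words : ∀ k → length (words xs k) ≡ length xs ^ k
  length-words zero    = refl
  length-words (suc k) = trans (length-cartesianProductWith _∷_ xs (words xs k)) (cong (length xs *_) (length-words k))

subsets : (n : ℕ) → List (Subset n)
subsets = words (outside ∷ inside ∷ [])

∈-subsets : (p : Subset n) → p ∈ subsets n
∈-subsets = ∈-words λ { outside → here refl ; inside → there (here refl) }

subsets-unique : (n : ℕ) → Unique (subsets n)
subsets-unique = words-unique (((λ ()) ∷ []) ∷ [] ∷ [])

subsetsOfSize : (n k : ℕ) → List (Subset n)
subsetsOfSize n k = filter (λ p → ∣ p ∣ ℕ.≟ k) (subsets n)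

-- Pascal's recurrence, according to whether the first vertex belongs to the set.
length-subsetsOfSize : (n k : ℕ) → length (subsetsOfSize n k) ≡ n C k
length-subsetsOfSize n k = trans (sym (∑-ind (λ p → ∣ p ∣ ℕ.≟ k) (subsets n))) (count n k)
  where
  rec : ∀ n k → ∑ (subsets (suc n)) (λ p → ind (∣ p ∣ ℕ.≟ k)) ≡
                ∑ (subsets n) (λ p → ind (∣ p ∣ ℕ.≟ k)) + ∑ (subsets n) (λ p → ind (suc ∣ p ∣ ℕ.≟ k))
  rec n k = trans (∑-cartesianProductWith _∷_ (outside ∷ inside ∷ []) (subsets n) (λ p → ind (∣ p ∣ ℕ.≟ k)))
                  (cong (∑ (subsets n) (λ p → ind (∣ p ∣ ℕ.≟ k)) +_) (+-identityʳ _))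
  count : ∀ n k → ∑ (subsets n) (λ p → ind (∣ p ∣ ℕ.≟ k)) ≡ n C k
  count zero    zero    = refl
  count zero    (suc k) = sym (k>n⇒nCk≡0 {0} {suc k} (s≤s z≤n))
  count (suc n) zero    = trans (rec n 0) (trans (cong (_+ ∑ (subsets n) (λ _ → 0)) (count n 0))
    (trans (cong (n C 0 +_) (trans (∑-const (subsets n) 0) (*-zeroʳ (length (subsets n)))))  (+-identityʳ _)))
  count (suc n) (suc k) = trans (rec n (suc k)) (trans (cong₂ _+_ (count n (suc k)) (count n k))
    (trans (+-comm (n C suc k) (n C k)) (nCk+nC[k+1]≡[n+1]C[k+1] n k)))

-- Homogeneous families of tuples

-- Each step costs a factor r L for the popular vertex and one of (number of position sets) * r for the
-- most frequent pair (P , i) of a position set and a position it determines.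
threshold : ℕ → ℕ → ℕ → ℕ
threshold r L zero    = 1
threshold r L (suc k) = suc (r * L * (suc k * r * threshold r L k))

threshold≥1 : ∀ r L k → 1 ≤ threshold r L k
threshold≥1 r L zero    = ≤-refl
threshold≥1 r L (suc k) = s≤s z≤n

opaque
  -- Every round of the extraction settles one position set, so there are at most as many rounds as
  -- position sets. Later arguments use only that this factor is independent of the number of
  -- vertices, hence `opaque`.
  loss : ℕ → ℕ → ℕ
  loss r L = threshold r L (length (subsets r))

module Positions {n r : ℕ} (L : ℕ) {X : Set} (v : X → Fin r → Fin n) where

  Agree : Subset r → X → X → Set
  Agree P x y = ∀ i → i ∈ₛ P → v x i ≡ v y i

  agree? : ∀ P x y → Dec (Agree P x y)
  agree? P x y = Fin.all? (λ i → (i ∈? P) →-dec (v x i Fin.≟ v y i))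

  Avoids : Subset r → Subset n → X → Set
  Avoids P F y = ∀ i → i ∉ₛ P → v y i ∉ₛ F

  Flex : Subset r → List X → X → Set
  Flex P G x = ∀ F → ∣ F ∣ ≤ L → ∃ λ y → y ∈ G × Agree P x y × Avoids P F y

  Meets : Subset r → Subset n → X → Set
  Meets P F y = ∃ λ i → i ∉ₛ P × v y i ∈ₛ F

  Blocks : Subset r → List X → X → Subset n → Set
  Blocks P G x F = ∣ F ∣ ≤ L × All (λ y → Agree P x y → Meets P F y) G

  meets? : ∀ P F y → Dec (Meets P F y)
  meets? P F y = Fin.any? (λ i → ¬? (i ∈? P) ×-dec (v y i ∈? F))

  -- Searching all vertex sets `F` turns a failure of flexibility into one concrete blocking set.
  flexOrBlocked : ∀ P G x → Flex P G x ⊎ ∃ (Blocks P G x)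
  flexOrBlocked P G x
    with anySubset? (λ F → (∣ F ∣ ≤? L) ×-dec All.all? (λ y → agree? P x y →-dec meets? P F y) G)
  ... | yes blocked = inj₂ blocked
  ... | no ¬blocked = inj₁ flex
    where
    flex : Flex P G x
    flex F F≤ with Any.any? (λ y → agree? P x y ×-dec ¬? (meets? P F y)) G
    ... | yes any with find any
    ... | y , y∈ , ag , ¬meets = y , y∈ , ag , λ i i∉ vi∈ → ¬meets (i , i∉ , vi∈)
    flex F F≤ | no ¬any = contradiction
      (F , F≤ , All.tabulate (λ {y} y∈ ag → decidable-stable (meets? P F y) (λ ¬meets → ¬any (lose y∈ (ag , ¬meets)))))
      ¬blocked

  Determines : Subset r → Fin r → List X → Set
  Determines P i G = ∀ {x y} → x ∈ G → y ∈ G → Agree P x y → v x i ≡ v y i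

  -- The outcome of deleting whole fibres of blocked edges until none is left. `core` is what
  -- survives; `peel` retains, from each deleted fibre, the edges sharing the popular vertex, tagged
  -- with the blocked set `P` and the position `i` of that vertex. Retaining only these costs the
  -- factor `r * L`.
  record Peeling (Ps : List (Subset r)) (G : List X) : Set where
    field
      core        : List X
      core⊆       : ∀ {x} → x ∈ core → x ∈ G
      core-unique : Unique core
      core-flex   : ∀ {P} → P ∈ Ps → ∀ {x} → x ∈ core → Flex P core x
      peel        : List (X × Subset r × Fin r)
      peel⊆       : ∀ {x P i} → (x , P , i) ∈ peel → x ∈ G × P ∈ Ps × i ∉ₛ P
      peel-unique : AllPairs (λ d d′ → proj₁ d ≢ proj₁ d′) peel
      determined  : ∀ {x y P i} → (x , P , i) ∈ peel → (y , P , i) ∈ peel → Agree P x y → v x i ≡ v y i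
      length≤     : length G ≤ length core + r * L * length peel

  open Peeling

  -- Every edge that agrees with `x` on `P` meets `F` at a position outside `P`. There are at most
  -- `r * L` pairs of such a position and a vertex of `F`, so one pair is frequent in the fibre.
  popular : ∀ {P G x F} → Blocks P G x F → x ∈ G → let Φ = filter (agree? P x) G in
            ∃₂ λ i u → i ∉ₛ P × length Φ ≤ r * L * length (filter (λ y → v y i Fin.≟ u) Φ)
  popular {P} {G} {x} {F} (F≤ , blocks) x∈G = fromPigeonhole
    (pigeonhole (λ y (i , u) → v y i Fin.≟ u) (cartesianProduct is us) Φ covered (∈-length x∈Φ))
    where
    open ≤-Reasoning
    Φ = filter (agree? P x) G
    is = filter (λ i → ¬? (i ∈? P)) (allFin r)
    us = List.tabulate (enum F)
    x∈Φ : x ∈ Φ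
    x∈Φ = ∈-filter⁺ (agree? P x) x∈G (λ _ _ → refl)
    covered : ∀ {y} → y ∈ Φ → ∃ λ t → t ∈ cartesianProduct is us × v y (proj₁ t) ≡ proj₂ t
    covered y∈ with ∈-filter⁻ (agree? P x) {xs = G} y∈
    ... | y∈G , ag with All.lookup blocks y∈G ag
    ... | i , i∉ , vi∈ with enum-surjective F vi∈
    ... | j , eq = (i , enum F j) ,
      ∈-cartesianProduct⁺ (∈-filter⁺ (λ i → ¬? (i ∈? P)) (∈-allFin i) i∉) (∈-tabulate⁺ j) , sym eq
    tags≤ : length (cartesianProduct is us) ≤ r * L
    tags≤ = begin
      length (cartesianProduct is us) ≡⟨ length-cartesianProductWith _,_ is us ⟩
      length is * length us           ≤⟨ *-mono-≤ (length-filter (λ i → ¬? (i ∈? P)) (allFin r))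
                                                  (≤-reflexive (length-tabulate (enum F))) ⟩
      length (allFin r) * ∣ F ∣       ≤⟨ *-mono-≤ (≤-reflexive (length-tabulate {n = r} id)) F≤ ⟩
      r * L                           ∎
    fromPigeonhole : (∃ λ t → t ∈ cartesianProduct is us ×
        length Φ ≤ length (cartesianProduct is us) * length (filter (λ y → v y (proj₁ t) Fin.≟ proj₂ t) Φ)) →
      ∃₂ λ i u → i ∉ₛ P × length Φ ≤ r * L * length (filter (λ y → v y i Fin.≟ u) Φ)
    fromPigeonhole ((i , u) , t∈ , le) = i , u ,
      proj₂ (∈-filter⁻ (λ i → ¬? (i ∈? P)) {xs = allFin r} (proj₁ (∈-cartesianProduct⁻ is us t∈))) ,
      ≤-trans le (*-monoˡ-≤ _ tags≤)

  -- Removing the whole fibre of a blocked edge at once keeps the peeled tuples determined: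
  -- edges that agree on P were peeled off at the same step, where they share the popular value.
  peeling : ∀ Ps N G → length G ≤ N → Unique G → Peeling Ps G
  peeling Ps N G len≤ G-unique with All.decide (λ P → All.decide (λ x → flexOrBlocked P G x) G) Ps
  ... | inj₁ all-flex = record
    { core        = G
    ; core⊆       = id
    ; core-unique = G-unique
    ; core-flex   = λ P∈ x∈ → All.lookup (All.lookup all-flex P∈) x∈
    ; peel        = []
    ; peel⊆       = λ ()
    ; peel-unique = AllPairs.[]
    ; determined  = λ ()
    ; length≤     = m≤m+n (length G) _
    }
  ... | inj₂ any with find any
  ... | P , P∈ , any′ with find any′
  ... | x , x∈G , F , blocked with popular blocked x∈G
  peeling Ps zero    (_ ∷ _) () _ | inj₂ _ | P , P∈ , _ | x , x∈G , F , blocked | i , u , i∉P , le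
  peeling Ps zero    []      _  _ | inj₂ _ | P , P∈ , _ | x , ()  , F , blocked | i , u , i∉P , le
  peeling Ps (suc N) G len≤ G-unique | inj₂ _ | P , P∈ , _ | x , x∈G , F , blocked | i , u , i∉P , le = record
    { core        = core rest
    ; core⊆       = rest⊆ ∘ core⊆ rest
    ; core-unique = core-unique rest
    ; core-flex   = core-flex rest
    ; peel        = new ++ peel rest
    ; peel⊆       = λ d∈ → [ new⊆ , old⊆ ]′ (∈-++⁻ new d∈)
    ; peel-unique = AllPairs.++⁺ (AllPairs.map⁺ (Unique.filter⁺ _ (Unique.filter⁺ (agree? P x) G-unique)))
                      (peel-unique rest)
                      (All.tabulate λ d∈ → All.tabulate λ d′∈ → new≢old d∈ d′∈)
    ; determined  = λ d∈ d′∈ → determined′ (∈-++⁻ new d∈) (∈-++⁻ new d′∈)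
    ; length≤     = size≤
    }
    where
    Φ = filter (agree? P x) G
    Φ′ = filter (λ y → v y i Fin.≟ u) Φ
    R = filter (¬? ∘ agree? P x) G
    new : List (X × Subset r × Fin r)
    new = map (_, P , i) Φ′
    Φ-size : 0 < length Φ
    Φ-size = ∈-length (∈-filter⁺ (agree? P x) x∈G (λ _ _ → refl))
    R-size : length R ≤ N
    R-size = s≤s⁻¹ (≤-trans (≤-trans (+-monoˡ-≤ (length R) Φ-size) (≤-reflexive (length-filter-¬ (agree? P x) G))) len≤)
    rest : Peeling Ps R
    rest = peeling Ps N R R-size (Unique.filter⁺ (¬? ∘ agree? P x) G-unique)
    rest⊆ : ∀ {y} → y ∈ R → y ∈ G
    rest⊆ y∈ = proj₁ (∈-filter⁻ (¬? ∘ agree? P x) {xs = G} y∈)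
    new⁻ : ∀ {y Q j} → (y , Q , j) ∈ new → (Q ≡ P × j ≡ i) × y ∈ G × Agree P x y × v y i ≡ u
    new⁻ d∈ with ∈-map⁻ (_, P , i) d∈
    ... | y , y∈ , refl with ∈-filter⁻ (λ y → v y i Fin.≟ u) {xs = Φ} y∈
    ... | y∈Φ , eq with ∈-filter⁻ (agree? P x) {xs = G} y∈Φ
    ... | y∈G , ag = (refl , refl) , y∈G , ag , eq
    new⊆ : ∀ {y Q j} → (y , Q , j) ∈ new → y ∈ G × Q ∈ Ps × j ∉ₛ Q
    new⊆ d∈ with new⁻ d∈
    ... | (refl , refl) , y∈G , _ = y∈G , P∈ , i∉P
    old⊆ : ∀ {y Q j} → (y , Q , j) ∈ peel rest → y ∈ G × Q ∈ Ps × j ∉ₛ Q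
    old⊆ d∈ with peel⊆ rest d∈
    ... | y∈R , Q∈ , j∉ = rest⊆ y∈R , Q∈ , j∉
    old-disagrees : ∀ {y Q j} → (y , Q , j) ∈ peel rest → ¬ Agree P x y
    old-disagrees d∈ = proj₂ (∈-filter⁻ (¬? ∘ agree? P x) {xs = G} (proj₁ (peel⊆ rest d∈)))
    new≢old : ∀ {d d′} → d ∈ new → d′ ∈ peel rest → proj₁ d ≢ proj₁ d′
    new≢old d∈ d′∈ refl = old-disagrees d′∈ (proj₁ (proj₂ (proj₂ (new⁻ d∈))))
    determined′ : ∀ {y z Q j} → (y , Q , j) ∈ new ⊎ (y , Q , j) ∈ peel rest →
                  (z , Q , j) ∈ new ⊎ (z , Q , j) ∈ peel rest → Agree Q y z → v y j ≡ v z j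
    determined′ (inj₁ d∈) (inj₁ d′∈) _ with new⁻ d∈ | new⁻ d′∈
    ... | (refl , refl) , _ , _ , eq | _ , _ , _ , eq′ = trans eq (sym eq′)
    determined′ (inj₁ d∈) (inj₂ d′∈) yz with new⁻ d∈
    ... | (refl , refl) , _ , xy , _ = contradiction (λ k k∈ → trans (xy k k∈) (yz k k∈)) (old-disagrees d′∈)
    determined′ (inj₂ d∈) (inj₁ d′∈) yz with new⁻ d′∈
    ... | (refl , refl) , _ , xz , _ = contradiction (λ k k∈ → trans (xz k k∈) (sym (yz k k∈))) (old-disagrees d∈)
    determined′ (inj₂ d∈) (inj₂ d′∈) yz = determined rest d∈ d′∈ yz
    size≤ : length G ≤ length (core rest) + r * L * length (new ++ peel rest)
    size≤ = begin
      length G                                           ≡⟨ length-filter-¬ (agree? P x) G ⟨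
      length Φ + length R                                ≤⟨ +-mono-≤ le (length≤ rest) ⟩
      r * L * length Φ′ + (length (core rest) + r * L * length (peel rest))
        ≡⟨ arith (r * L) (length Φ′) (length (core rest)) (length (peel rest)) ⟩
      length (core rest) + r * L * (length Φ′ + length (peel rest))
        ≡⟨ cong (λ z → length (core rest) + r * L * z)
             (trans (cong (_+ length (peel rest)) (sym (length-map (_, P , i) Φ′))) (sym (length-++ new))) ⟩
      length (core rest) + r * L * length (new ++ peel rest) ∎
      where
      open ≤-Reasoning
      open +-*-Solver
      arith : ∀ c p q s → c * p + (q + c * s) ≡ q + c * (p + s)
      arith = solve 4 (λ c p q s → c :* p :+ (q :+ c :* s) := q :+ c :* (p :+ s)) refl

  FlexOrDetermined : List X → Subset r → Set
  FlexOrDetermined G P = (∀ {x} → x ∈ G → Flex P G x) ⊎ ∃ λ i → i ∉ₛ P × Determines P i G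

  -- If the core is large, every set in `Ps` is flexible there. Otherwise the peeled edges are
  -- numerous, and those with the most frequent tag `(P , i)` form a family in which `P` determines
  -- `i`; `P` is struck off and the argument repeated inside this family. Determination passes to
  -- subfamilies and flexibility need not, so flexibility is claimed only for the core of the last
  -- round.
  homogeneous : ∀ k Ps → length Ps ≤ k → ∀ m G → Unique G → threshold r L k * m < length G →
                ∃ λ G′ → (∀ {x} → x ∈ G′ → x ∈ G) × Unique G′ × m < length G′ ×
                         (∀ {P} → P ∈ Ps → FlexOrDetermined G′ P)
  homogeneous k Ps Ps≤ m G G-unique big with peeling Ps (length G) G ≤-refl G-unique
  ... | pl with m ℕ.<? length (core pl)
  ... | yes m< = core pl , core⊆ pl , core-unique pl , m< , λ P∈ → inj₁ (core-flex pl P∈)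
  ... | no m≮ = fromPeel k Ps≤ big (peel pl) refl
    where
    open ≤-Reasoning
    core≤ = ≮⇒≥ m≮
    fromPeel : ∀ k → length Ps ≤ k → threshold r L k * m < length G → ∀ D → D ≡ peel pl →
               ∃ λ G′ → (∀ {x} → x ∈ G′ → x ∈ G) × Unique G′ × m < length G′ ×
                        (∀ {P} → P ∈ Ps → FlexOrDetermined G′ P)
    fromPeel k _ big [] eq = contradiction big (≤⇒≯ (begin
      length G                                      ≤⟨ length≤ pl ⟩
      length (core pl) + r * L * length (peel pl)   ≡⟨ cong (λ D → length (core pl) + r * L * length D) (sym eq) ⟩
      length (core pl) + r * L * 0                  ≡⟨ cong (length (core pl) +_) (*-zeroʳ (r * L)) ⟩
      length (core pl) + 0                          ≡⟨ +-identityʳ _ ⟩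
      length (core pl)                              ≤⟨ core≤ ⟩
      m                                             ≡⟨ *-identityˡ m ⟨
      1 * m                                         ≤⟨ *-monoˡ-≤ m (threshold≥1 r L k) ⟩
      threshold r L k * m                               ∎))
    fromPeel zero Ps≤0 _ ((x , P , i) ∷ _) eq =
      contradiction (≤-trans (∈-length (proj₁ (proj₂ (peel⊆ pl (subst ((x , P , i) ∈_) eq (here refl)))))) Ps≤0) λ ()
    fromPeel (suc k) Ps≤ big (_ ∷ _) eq = fromPigeonhole
      (pigeonhole (λ d t → ≡-dec _≟ₛ_ Fin._≟_ (proj₂ d) t) tags (peel pl) covered
        (subst (λ D → 0 < length D) eq (s≤s z≤n)))
      where
      tags = cartesianProduct Ps (allFin r)
      covered : ∀ {d} → d ∈ peel pl → ∃ λ t → t ∈ tags × proj₂ d ≡ t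
      covered {x , P , i} d∈ = (P , i) , ∈-cartesianProduct⁺ (proj₁ (proj₂ (peel⊆ pl d∈))) (∈-allFin i) , refl
      fromPigeonhole : (∃ λ t → t ∈ tags ×
          length (peel pl) ≤ length tags * length (filter (λ d → ≡-dec _≟ₛ_ Fin._≟_ (proj₂ d) t) (peel pl))) →
        ∃ λ G′ → (∀ {x} → x ∈ G′ → x ∈ G) × Unique G′ × m < length G′ ×
                 (∀ {P} → P ∈ Ps → FlexOrDetermined G′ P)
      fromPigeonhole ((P , i) , t∈ , le) = conclude
        (homogeneous k Ps′ Ps′≤ m (map proj₁ D)
          (AllPairs.map⁺ (AllPairs.filter⁺ (λ d → ≡-dec _≟ₛ_ Fin._≟_ (proj₂ d) (P , i)) (peel-unique pl))) D-big)
        where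
        D = filter (λ d → ≡-dec _≟ₛ_ Fin._≟_ (proj₂ d) (P , i)) (peel pl)
        P∈ = proj₁ (∈-cartesianProduct⁻ Ps (allFin r) t∈)
        Ps′ = filter (λ Q → ¬? (Q ≟ₛ P)) Ps
        Ps′≤ : length Ps′ ≤ k
        Ps′≤ = s≤s⁻¹ (≤-trans (filter-notAll (λ Q → ¬? (Q ≟ₛ P)) Ps (lose P∈ (λ ≢ → ≢ refl))) Ps≤)
        D⁻ : ∀ {x} → x ∈ map proj₁ D → (x , P , i) ∈ peel pl
        D⁻ x∈ with ∈-map⁻ proj₁ x∈
        ... | (x , _) , d∈ , refl with ∈-filter⁻ (λ d → ≡-dec _≟ₛ_ Fin._≟_ (proj₂ d) (P , i)) {xs = peel pl} d∈
        ... | d∈peel , refl = d∈peel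
        tags≤ : length tags ≤ suc k * r
        tags≤ = ≤-trans (≤-reflexive (length-cartesianProductWith _,_ Ps (allFin r)))
                        (*-mono-≤ Ps≤ (≤-reflexive (length-tabulate {n = r} id)))
        D-big : threshold r L k * m < length (map proj₁ D)
        D-big = ≰⇒> λ D≤ → <⇒≱ big (begin
          length G                                              ≤⟨ length≤ pl ⟩
          length (core pl) + r * L * length (peel pl)           ≤⟨ +-mono-≤ core≤ (*-monoʳ-≤ (r * L) le) ⟩
          m + r * L * (length tags * length D)
            ≤⟨ +-monoʳ-≤ m (*-monoʳ-≤ (r * L) (*-mono-≤ tags≤ (≤-trans (≤-reflexive (sym (length-map proj₁ D))) D≤))) ⟩
          m + r * L * (suc k * r * (threshold r L k * m))           ≡⟨ arith m (r * L) (suc k * r) (threshold r L k) ⟩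
          threshold r L (suc k) * m                                 ∎)
          where
          open +-*-Solver
          arith : ∀ m c p t → m + c * (p * (t * m)) ≡ suc (c * (p * t)) * m
          arith = solve 4 (λ m c p t → m :+ c :* (p :* (t :* m)) := (con 1 :+ c :* (p :* t)) :* m) refl
        conclude : (∃ λ G′ → (∀ {x} → x ∈ G′ → x ∈ map proj₁ D) × Unique G′ × m < length G′ ×
                             (∀ {P} → P ∈ Ps′ → FlexOrDetermined G′ P)) →
                   ∃ λ G′ → (∀ {x} → x ∈ G′ → x ∈ G) × Unique G′ × m < length G′ ×
                            (∀ {P} → P ∈ Ps → FlexOrDetermined G′ P)
        conclude (G′ , G′⊆ , u , m< , fd) = G′ , (λ x∈ → proj₁ (peel⊆ pl (D⁻ (G′⊆ x∈)))) , u , m< , fd′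
          where
          fd′ : ∀ {Q} → Q ∈ Ps → FlexOrDetermined G′ Q
          fd′ {Q} Q∈ with Q ≟ₛ P
          -- That `i` lies outside `P` is read off any surviving edge; one exists because the length
          -- of `G′` exceeds `m`.
          ... | yes refl = inj₂ (i , proj₂ (proj₂ (peel⊆ pl (D⁻ (G′⊆ (∈-lookup (fromℕ< m<)))))) ,
                                 λ x∈ y∈ → determined pl (D⁻ (G′⊆ x∈)) (D⁻ (G′⊆ y∈)))
          ... | no Q≢P = fd (∈-filter⁺ (λ Q → ¬? (Q ≟ₛ P)) Q∈ Q≢P)

  opaque
    unfolding loss

    homogeneousAll : ∀ m G → Unique G → loss r L * m < length G →
                     ∃ λ G′ → (∀ {x} → x ∈ G′ → x ∈ G) × Unique G′ × m < length G′ ×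
                              (∀ P → FlexOrDetermined G′ P)
    homogeneousAll m G G-unique big with homogeneous (length (subsets r)) (subsets r) ≤-refl m G G-unique big
    ... | G′ , G′⊆ , u , m< , fd = G′ , G′⊆ , u , m< , λ P → fd (∈-subsets P)

-- Forced positions

-- Of `ν` forced positions, `i` go into the `a`-part and the rest into the `b`-part, and neither
-- number may be 1. For `ν = 3` one part must take all three, which is where `5 ≤ a + b` enters. For
-- `ν ≥ 4` two go into the `a`-part, unless the rest would overflow the `b`-part; then the `b`-part
-- is filled completely.
split-size : ∀ a b ν → 2 ≤ a → 2 ≤ b → 5 ≤ a + b → ν ≤ a + b → ν ≢ 1 →
             ∃₂ λ i j → i + j ≡ a × i ≤ ν × ν ≤ i + b × i ≢ 1 × (∀ m → i + m ≡ ν → m ≢ 1)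
split-size a b 0 _ _ _ _ _ = 0 , a , refl , z≤n , z≤n , (λ ()) , λ { .0 refl () }
split-size a b 1 _ _ _ _ ≢1 = contradiction refl ≢1
split-size (suc (suc a)) b 2 _ _ _ _ _ = 2 , a , refl , ≤-refl , m≤m+n 2 b , (λ ()) , λ { .0 refl () }
split-size 2 b 3 _ _ 5≤ _ _ = 0 , 2 , refl , z≤n , s≤s⁻¹ (s≤s⁻¹ 5≤) , (λ ()) , λ { .3 refl () }
split-size (suc (suc (suc a))) b 3 _ _ _ _ _ = 3 , a , refl , ≤-refl , m≤m+n 3 b , (λ ()) , λ { .0 refl () }
split-size 1 b 3 (s≤s ()) _ _ _ _
split-size 1 b 2 (s≤s ()) _ _ _ _
split-size (suc a) b (suc (suc (suc (suc ν)))) 2≤a 2≤b _ ν≤ _ with suc (suc (suc (suc ν))) ≤? 2 + b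
split-size (suc (suc a)) b (suc (suc (suc (suc ν)))) _ _ _ _ _ | yes le =
  2 , a , refl , s≤s (s≤s z≤n) , le , (λ ()) , λ { .(suc (suc ν)) refl () }
split-size 1 b (suc (suc (suc (suc ν)))) (s≤s ()) _ _ _ _ | _
split-size (suc a) b ν@(suc (suc (suc (suc _)))) 2≤a 2≤b _ ν≤ _ | no ≰ =
  ν ∸ b , suc a ∸ (ν ∸ b) , m+[n∸m]≡n i≤a , m∸n≤m ν b , ≤-reflexive (sym (m∸n+n≡m b≤ν)) , i≢1 ,
  λ m eq m≡1 → <⇒≢ 2≤b (sym (trans (+-cancelˡ-≡ (ν ∸ b) b m (trans (m∸n+n≡m b≤ν) (sym eq))) m≡1))
  where
  2+b≤ν : 2 + b ≤ ν
  2+b≤ν = <⇒≤ (≰⇒> ≰)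
  b≤ν : b ≤ ν
  b≤ν = ≤-trans (m≤n+m b 2) 2+b≤ν
  i≤a : ν ∸ b ≤ suc a
  i≤a = ≤-trans (∸-monoˡ-≤ b ν≤) (≤-reflexive (m+n∸n≡m (suc a) b))
  i≢1 : ν ∸ b ≢ 1
  i≢1 eq = <⇒≢ (≤-trans (≤-reflexive (sym (m+n∸n≡m 2 b))) (∸-monoˡ-≤ b 2+b≤ν)) (sym eq)

module Homogeneous {n ρ : ℕ} (L : ℕ) (1≤L : 1 ≤ L) {X : Set} (v : X → Fin (2 + ρ) → Fin n)
  (v-ext : ∀ {x y} → (∀ i → v x i ≡ v y i) → x ≡ y)
  (G : List X) (G-unique : Unique G) (G-big : n ^ ρ < length G)
  (fd : ∀ P → Positions.FlexOrDetermined L v G P) where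

  open Positions L v

  private
    r = 2 + ρ

  Flexible : Subset r → Set
  Flexible P = ∀ {x} → x ∈ G → Flex P G x

  -- If `i` were outside `Q`, some edge would agree with `x` on `Q`, hence on `P`, and yet avoid the
  -- vertex `v x i` at position `i`.
  flexible⇒closed : ∀ {P Q i} → Flexible Q → Determines P i G → P ⊆ₛ Q → i ∈ₛ Q
  flexible⇒closed {P} {Q} {i} flex det P⊆Q with i ∈? Q
  ... | yes i∈Q = i∈Q
  ... | no  i∉Q = contradiction (subst (_∈ₛ ⁅ v x i ⁆) same (x∈⁅x⁆ (v x i))) (proj₂ (proj₂ (proj₂ moved)) i i∉Q)
    where
    x = lookup G (fromℕ< G-big)
    moved : ∃ λ y → y ∈ G × Agree Q x y × Avoids Q ⁅ v x i ⁆ y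
    moved = flex (∈-lookup (fromℕ< G-big)) ⁅ v x i ⁆ (≤-trans (≤-reflexive (∣⁅x⁆∣≡1 (v x i))) 1≤L)
    same : v x i ≡ v (proj₁ moved) i
    same = det (∈-lookup (fromℕ< G-big)) (proj₁ (proj₂ moved)) (λ k k∈ → proj₁ (proj₂ (proj₂ moved)) k (P⊆Q k∈))

  -- Two determined coordinates leave at most n ^ ρ edges.
  ¬both-determined : ∀ {i j} → i ≢ j → Determines (∁ (⁅ i ⁆ ∪ ⁅ j ⁆)) i G → Determines (∁ ⁅ j ⁆) j G → ⊥
  ¬both-determined {i} {j} i≢j det-i det-j = <⇒≱ G-big (Fin.injective⇒≤ {f = code} code-injective)
    where
    restrict : X → Fin ρ → Fin n
    restrict x k = v x (punchIn i (punchIn (punchOut i≢j) k))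
    code : Fin (length G) → Fin (n ^ ρ)
    code t = funToFin (restrict (lookup G t))
    code-injective : Injective _≡_ _≡_ code
    code-injective {t} {t′} eq = lookup-injective G-unique (v-ext everywhere)
      where
      x = lookup G t
      y = lookup G t′
      off-ij : ∀ k → i ≢ k → j ≢ k → v x k ≡ v y k
      off-ij k i≢k j≢k = subst (λ k → v x k ≡ v y k)
        (trans (cong (punchIn i) (Fin.punchIn-punchOut j′≢k′)) (Fin.punchIn-punchOut i≢k))
        (trans (sym (Fin.finToFun-funToFin (restrict x) k″))
        (trans (cong (λ c → finToFun c k″) eq) (Fin.finToFun-funToFin (restrict y) k″)))
        where
        j′≢k′ : punchOut i≢j ≢ punchOut i≢k
        j′≢k′ = j≢k ∘ Fin.punchOut-injective i≢j i≢k
        k″ = punchOut j′≢k′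
      at-i : v x i ≡ v y i
      at-i = det-i (∈-lookup t) (∈-lookup t′) λ k k∈ → off-ij k
        (λ { refl → x∈∁p⇒x∉p k∈ (x∈p∪q⁺ (inj₁ (x∈⁅x⁆ i))) })
        (λ { refl → x∈∁p⇒x∉p k∈ (x∈p∪q⁺ (inj₂ (x∈⁅x⁆ j))) })
      off-j : ∀ k → j ≢ k → v x k ≡ v y k
      off-j k j≢k with i Fin.≟ k
      ... | yes refl = at-i
      ... | no  i≢k  = off-ij k i≢k j≢k
      everywhere : ∀ k → v x k ≡ v y k
      everywhere k with j Fin.≟ k
      ... | yes refl = det-j (∈-lookup t) (∈-lookup t′) λ k k∈ →
                         off-j k λ { refl → x∈∁p⇒x∉p k∈ (x∈⁅x⁆ j) }
      ... | no  j≢k  = off-j k j≢k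

  i∉∁⁅i⁆ : ∀ (i : Fin r) → i ∉ₛ ∁ ⁅ i ⁆
  i∉∁⁅i⁆ i i∈ = x∈∁p⇒x∉p i∈ (x∈⁅x⁆ i)

  -- The dichotomy `fd` decides this: a flexible `∁ ⁅ i ⁆` determines nothing outside itself, and
  -- otherwise the determined position can only be `i`.
  forced? : ∀ i → Dec (Determines (∁ ⁅ i ⁆) i G)
  forced? i with fd (∁ ⁅ i ⁆)
  ... | inj₁ flex = no λ det → i∉∁⁅i⁆ i (flexible⇒closed flex det id)
  ... | inj₂ (j , j∉ , det) = yes (subst (λ k → Determines (∁ ⁅ i ⁆) k G) j≡i det)
    where
    j≡i : j ≡ i
    j≡i = decidable-stable (j Fin.≟ i) (λ j≢i → j∉ (x∉p⇒x∈∁p (j≢i ∘ x∈⁅y⁆⇒x≡y i)))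

  Forced : Subset r
  Forced = select forced?

  unforced⇒flexible : ∀ {i} → i ∉ₛ Forced → Flexible (∁ ⁅ i ⁆)
  unforced⇒flexible {i} i∉ with fd (∁ ⁅ i ⁆)
  ... | inj₁ flex = flex
  ... | inj₂ (j , j∉ , det) = contradiction (∈-select⁺ forced? (subst (λ k → Determines (∁ ⁅ i ⁆) k G) j≡i det)) i∉
    where
    j≡i : j ≡ i
    j≡i = decidable-stable (j Fin.≟ i) (λ j≢i → j∉ (x∉p⇒x∈∁p (j≢i ∘ x∈⁅y⁆⇒x≡y i)))

  -- The hypothesis says that `P` does not miss exactly one forced position. Suppose `P` determines
  -- some `i` outside it; then no flexible set containing `P` can omit `i`. If `i` is not forced,
  -- `∁ ⁅ i ⁆` is such a set. If `i` is forced, take a second missed forced position `j`: the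
  -- complement of both is either flexible, which is again impossible, or determines one of them,
  -- and then the family would be too small.
  flexible : ∀ P → (∀ {i} → i ∈ₛ Forced → i ∉ₛ P → ∃ λ j → j ∈ₛ Forced × j ∉ₛ P × j ≢ i) → Flexible P
  flexible P another with fd P
  ... | inj₁ flex = flex
  ... | inj₂ (i , i∉P , det) with i ∈? Forced
  ... | no i∉N = contradiction
    (flexible⇒closed (unforced⇒flexible i∉N) det λ {k} k∈P → x∉p⇒x∈∁p λ k∈ → i∉P (subst (_∈ₛ P) (x∈⁅y⁆⇒x≡y i k∈) k∈P))
    (i∉∁⁅i⁆ i)
  ... | yes i∈N with another i∈N i∉P
  ... | j , j∈N , j∉P , j≢i with fd (∁ (⁅ i ⁆ ∪ ⁅ j ⁆))
  ... | inj₁ flex = contradiction (x∈p∪q⁺ (inj₁ (x∈⁅x⁆ i))) (x∈∁p⇒x∉p (flexible⇒closed flex det P⊆))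
    where
    P⊆ : P ⊆ₛ ∁ (⁅ i ⁆ ∪ ⁅ j ⁆)
    P⊆ {k} k∈P = x∉p⇒x∈∁p λ k∈ →
      [ (λ k∈i → i∉P (subst (_∈ₛ P) (x∈⁅y⁆⇒x≡y i k∈i) k∈P))
      , (λ k∈j → j∉P (subst (_∈ₛ P) (x∈⁅y⁆⇒x≡y j k∈j) k∈P)) ]′ (x∈p∪q⁻ ⁅ i ⁆ ⁅ j ⁆ k∈)
  ... | inj₂ (k , k∉ , det-k) with k Fin.≟ i
  ... | yes refl = ⊥-elim (¬both-determined (≢-sym j≢i) det-k (∈-select⁻ forced? j∈N))
  ... | no k≢i with k Fin.≟ j
  ... | yes refl = ⊥-elim (¬both-determined j≢i
    (subst (λ Q → Determines (∁ Q) j G) (∪-comm ⁅ i ⁆ ⁅ j ⁆) det-k) (∈-select⁻ forced? i∈N))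
  ... | no k≢j = contradiction (x∉p⇒x∈∁p λ k∈ →
      [ k≢i ∘ x∈⁅y⁆⇒x≡y i , k≢j ∘ x∈⁅y⁆⇒x≡y j ]′ (x∈p∪q⁻ ⁅ i ⁆ ⁅ j ⁆ k∈)) k∉

  -- If just one position is forced, a set containing it misses no forced position. Otherwise the
  -- numbers from `split-size` yield a `P` such that neither `P` nor `∁ P` misses exactly one.
  centreOrSplit : ∀ a b → a + b ≡ r → 2 ≤ a → 2 ≤ b → 5 ≤ r →
                  (∃ λ i → ∀ P → i ∈ₛ P → Flexible P) ⊎
                  (∃ λ P → ∣ P ∣ ≡ a × Flexible P × Flexible (∁ P))
  centreOrSplit a b a+b≡r 2≤a 2≤b 5≤r with ∣ Forced ∣ ℕ.≟ 1
  ... | yes ≡1 = inj₁ (c , λ P c∈P → flexible P λ {i} i∈ i∉ → contradiction (subst (_∈ₛ P) (c≡ i∈) c∈P) i∉)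
    where
    c = enumAs Forced ≡1 zero
    c≡ : ∀ {i} → i ∈ₛ Forced → c ≡ i
    c≡ i∈ with enumAs-surjective Forced ≡1 i∈
    ... | zero , eq = eq
  ... | no ≢1 with split-size a b ∣ Forced ∣ 2≤a 2≤b (≤-trans 5≤r (≤-reflexive (sym a+b≡r)))
                     (≤-trans (∣p∣≤n Forced) (≤-reflexive (sym a+b≡r))) ≢1
  ... | i , j , i+j≡a , i≤ν , ν≤i+b , i≢1 , rest≢1
    with ∃-split Forced i j i≤ν
           (≤-trans (≤-reflexive i+j≡a) (≤-trans (m≤m+n a b) (≤-reflexive a+b≡r)))
           (≤-trans (+-monoʳ-≤ j ν≤i+b) (≤-reflexive (trans (sym (+-assoc j i b))
             (trans (cong (_+ b) (trans (+-comm j i) i+j≡a)) a+b≡r))))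
  ... | P , ∣P∣≡ , ∣N∩P∣≡ = inj₂ (P , trans ∣P∣≡ i+j≡a ,
      flexible P (λ i∈N i∉P → outsideP i∈N i∉P) ,
      flexible (∁ P) (λ i∈N i∉∁P → insideP i∈N (decidable-stable (_ ∈? P) (λ i∉P → i∉∁P (x∉p⇒x∈∁p i∉P)))))
    where
    outsideP : ∀ {k} → k ∈ₛ Forced → k ∉ₛ P → ∃ λ l → l ∈ₛ Forced × l ∉ₛ P × l ≢ k
    outsideP k∈ k∉ with ∣p∣≢1⇒another (Forced ∩ ∁ P)
      (rest≢1 _ (trans (cong (_+ ∣ Forced ∩ ∁ P ∣) (sym ∣N∩P∣≡)) (∣p∩q∣+∣p∩∁q∣≡∣p∣ Forced P))) (∈-minus⁺ k∈ k∉)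
    ... | l , l∈ , l≢k = l , proj₁ (∈-minus⁻ l∈) , proj₂ (∈-minus⁻ l∈) , l≢k
    insideP : ∀ {k} → k ∈ₛ Forced → k ∈ₛ P → ∃ λ l → l ∈ₛ Forced × l ∉ₛ ∁ P × l ≢ k
    insideP k∈ k∈P with ∣p∣≢1⇒another (Forced ∩ P) (i≢1 ∘ trans (sym ∣N∩P∣≡)) (x∈p∩q⁺ (k∈ , k∈P))
    ... | l , l∈ , l≢k = l , proj₁ (x∈p∩q⁻ Forced P l∈) ,
      (λ l∈∁ → x∈∁p⇒x∉p l∈∁ (proj₂ (x∈p∩q⁻ Forced P l∈))) , l≢k

-- Building a bush greedily

Disjoint : Subset n → Subset n → Set
Disjoint p q = ∀ {x} → x ∈ₛ p → x ∉ₛ q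

⋃ : (Fin m → Subset n) → Subset n
⋃ {zero}  p = ⊥ₛ
⋃ {suc m} p = p zero ∪ ⋃ (p ∘ suc)

∈-⋃ : (p : Fin m → Subset n) (i : Fin m) {x : Fin n} → x ∈ₛ p i → x ∈ₛ ⋃ p
∈-⋃ p zero    x∈ = x∈p∪q⁺ (inj₁ x∈)
∈-⋃ p (suc i) x∈ = x∈p∪q⁺ (inj₂ (∈-⋃ (p ∘ suc) i x∈))

∣⋃∣≤ : (p : Fin m → Subset n) {c : ℕ} → (∀ i → ∣ p i ∣ ≤ c) → ∣ ⋃ p ∣ ≤ m * c
∣⋃∣≤ {zero}  {n} p ≤c = ≤-reflexive (∣⊥∣≡0 n)
∣⋃∣≤ {suc m} p ≤c = ≤-trans (∣p∪q∣≤∣p∣+∣q∣ (p zero) (⋃ (p ∘ suc))) (+-mono-≤ (≤c zero) (∣⋃∣≤ (p ∘ suc) (≤c ∘ suc)))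

module _ {n L c : ℕ} where

  -- K i is reserved for the choice of B i: the supply works only while K i is disjoint from what has to be
  -- avoided, so every other choice avoids K i as well.
  greedy : ∀ {q} (Q : Fin q → Subset n → Set) (K : Fin q → Subset n) (F : Subset n) →
           ∣ F ∣ + q * suc c ≤ L → (∀ i → ∣ K i ∣ ≤ 1) → (∀ i → Disjoint (K i) F) →
           (∀ {i j} → i ≢ j → Disjoint (K i) (K j)) →
           (∀ i F → ∣ F ∣ ≤ L → Disjoint (K i) F → ∃ λ B → Q i B × ∣ B ∣ ≤ c × Disjoint B F) →
           ∃ λ (B : Fin q → Subset n) → (∀ i → Q i (B i)) × (∀ i → Disjoint (B i) F) ×
             (∀ {i j} → i ≢ j → Disjoint (B i) (B j))
  greedy {zero} Q K F _ _ _ _ _ = (λ ()) , (λ ()) , (λ ()) , λ { {()} }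
  greedy {suc q} Q K F room ∣K∣≤1 K∩F K∩K supply
    with supply zero (F ∪ ⋃ (K ∘ suc)) small K₀∩
    where
    open ≤-Reasoning
    small : ∣ F ∪ ⋃ (K ∘ suc) ∣ ≤ L
    small = begin
      ∣ F ∪ ⋃ (K ∘ suc) ∣     ≤⟨ ∣p∪q∣≤∣p∣+∣q∣ F (⋃ (K ∘ suc)) ⟩
      ∣ F ∣ + ∣ ⋃ (K ∘ suc) ∣ ≤⟨ +-monoʳ-≤ ∣ F ∣ (∣⋃∣≤ (K ∘ suc) (∣K∣≤1 ∘ suc)) ⟩
      ∣ F ∣ + q * 1           ≤⟨ +-monoʳ-≤ ∣ F ∣ (*-mono-≤ (n≤1+n q) (s≤s (z≤n {c}))) ⟩
      ∣ F ∣ + suc q * suc c   ≤⟨ room ⟩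
      L                       ∎
    ∉⋃ : ∀ {x} q (p : Fin q → Subset n) → (∀ i → x ∉ₛ p i) → x ∉ₛ ⋃ p
    ∉⋃ zero    p x∉ x∈ = ∉⊥ x∈
    ∉⋃ (suc q) p x∉ x∈ = [ x∉ zero , ∉⋃ q (p ∘ suc) (x∉ ∘ suc) ]′ (x∈p∪q⁻ (p zero) (⋃ (p ∘ suc)) x∈)
    K₀∩ : Disjoint (K zero) (F ∪ ⋃ (K ∘ suc))
    K₀∩ x∈ x∈F = [ K∩F zero x∈ , ∉⋃ q (K ∘ suc) (λ i → K∩K (λ ()) x∈) ]′ (x∈p∪q⁻ F (⋃ (K ∘ suc)) x∈F)
  ... | B₀ , QB₀ , ∣B₀∣≤c , B₀∩
    with greedy (Q ∘ suc) (K ∘ suc) (F ∪ B₀) room′ (∣K∣≤1 ∘ suc) K∩F′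
           (λ i≢j → K∩K (i≢j ∘ Fin.suc-injective)) (supply ∘ suc)
    where
    open ≤-Reasoning
    room′ : ∣ F ∪ B₀ ∣ + q * suc c ≤ L
    room′ = begin
      ∣ F ∪ B₀ ∣ + q * suc c
        ≤⟨ +-monoˡ-≤ (q * suc c) (≤-trans (∣p∪q∣≤∣p∣+∣q∣ F B₀) (+-monoʳ-≤ ∣ F ∣ (m≤n⇒m≤1+n ∣B₀∣≤c))) ⟩
      ∣ F ∣ + suc c + q * suc c    ≡⟨ +-assoc ∣ F ∣ (suc c) (q * suc c) ⟩
      ∣ F ∣ + suc q * suc c        ≤⟨ room ⟩
      L                            ∎
    K∩F′ : ∀ i → Disjoint (K (suc i)) (F ∪ B₀)
    K∩F′ i x∈ x∈F = [ K∩F (suc i) x∈ , (λ x∈B₀ → B₀∩ x∈B₀ (x∈p∪q⁺ (inj₂ (∈-⋃ (K ∘ suc) i x∈)))) ]′ (x∈p∪q⁻ F B₀ x∈F)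
  ... | B , QB , B∩ , B∩B = B′ , QB′ , B∩′ , B∩B′
    where
    B′ : Fin (suc q) → Subset n
    B′ zero    = B₀
    B′ (suc i) = B i
    QB′ : ∀ i → Q i (B′ i)
    QB′ zero    = QB₀
    QB′ (suc i) = QB i
    B∩′ : ∀ i → Disjoint (B′ i) F
    B∩′ zero    x∈ x∈F = B₀∩ x∈ (x∈p∪q⁺ (inj₁ x∈F))
    B∩′ (suc i) x∈ x∈F = B∩ i x∈ (x∈p∪q⁺ (inj₁ x∈F))
    B∩B′ : ∀ {i j} → i ≢ j → Disjoint (B′ i) (B′ j)
    B∩B′ {zero}  {zero}  i≢j _   _   = i≢j refl
    B∩B′ {zero}  {suc j} _   x∈  x∈′ = B∩ j x∈′ (x∈p∪q⁺ (inj₂ x∈))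
    B∩B′ {suc i} {zero}  _   x∈  x∈′ = B∩ i x∈ (x∈p∪q⁺ (inj₂ x∈′))
    B∩B′ {suc i} {suc j} i≢j x∈  x∈′ = B∩B (i≢j ∘ cong suc) x∈ x∈′

-- The number of vertices that ever have to be avoided: those of the bush, and one further vertex per B_i
-- and A_{i,j} for the cores of the greedy choice.
reserve : ℕ → ℕ → ℕ → ℕ → ℕ
reserve a b s h = a + s * suc b + s * h * suc a

module Bush {n r : ℕ} (H : Hypergraph n r) (a b s h : ℕ) where

  L : ℕ
  L = reserve a b s h

  Extendable : Subset n → Set
  Extendable B = ∀ F → ∣ F ∣ ≤ L → ∃ λ A → ∣ A ∣ ≡ a × Disjoint A F × (B ∪ A) ∈ edges H

  -- `K` is the part of `B` that may be unavoidable: the singleton of a centre, or empty. Requiring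
  -- `B` to be extendable allows the sets A_{i,j} to be attached after all the B_i are chosen.
  Supply : Subset n → Subset n → Set
  Supply A K = ∀ F → ∣ F ∣ ≤ L → Disjoint K F →
               ∃ λ B → ∣ B ∣ ≡ b × Disjoint B F × (A ∪ B) ∈ edges H × Extendable B

  assemble : {A : Subset n} {B : Fin s → Subset n} {A′ : Fin s → Fin h → Subset n} →
             ∣ A ∣ ≡ a → (∀ i → ∣ B i ∣ ≡ b) → (∀ i j → ∣ A′ i j ∣ ≡ a) →
             (∀ i → Disjoint (B i) A) → (∀ {i j} → i ≢ j → Disjoint (B i) (B j)) →
             (∀ i j → Disjoint (A′ i j) A) → (∀ i j k → Disjoint (A′ i j) (B k)) →
             (∀ {i j i′ j′} → ¬ (i ≡ i′ × j ≡ j′) → Disjoint (A′ i j) (A′ i′ j′)) →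
             (∀ i → (A ∪ B i) ∈ edges H) → (∀ i j → (B i ∪ A′ i j) ∈ edges H) →
             ContainsBush a b s h H
  assemble {A} {B} {A′} ∣A∣ ∣B∣ ∣A′∣ B∩A B∩B A′∩A A′∩B A′∩A′ AB∈ BA′∈ =
    φ , φ-injective , (λ i → A ∪ B i , AB∈ i , edge₁ i) , (λ i j → B i ∪ A′ i j , BA′∈ i j , edge₂ i j)
    where
    φ : BushV a b s h → Fin n
    φ (vA x)       = enumAs A ∣A∣ x
    φ (vB i y)     = enumAs (B i) (∣B∣ i) y
    φ (vAij i j x) = enumAs (A′ i j) (∣A′∣ i j) x
    A∈ : ∀ x → φ (vA x) ∈ₛ A
    A∈ = enumAs-∈ A ∣A∣
    B∈ : ∀ i y → φ (vB i y) ∈ₛ B i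
    B∈ i = enumAs-∈ (B i) (∣B∣ i)
    A′∈ : ∀ i j x → φ (vAij i j x) ∈ₛ A′ i j
    A′∈ i j = enumAs-∈ (A′ i j) (∣A′∣ i j)
    φ-injective : Injective _≡_ _≡_ φ
    φ-injective {vA x} {vA x′} eq = cong vA (enumAs-injective A ∣A∣ eq)
    φ-injective {vA x} {vB i y} eq = contradiction (subst (_∈ₛ A) eq (A∈ x)) (B∩A i (B∈ i y))
    φ-injective {vA x} {vAij i j x′} eq = contradiction (subst (_∈ₛ A) eq (A∈ x)) (A′∩A i j (A′∈ i j x′))
    φ-injective {vB i y} {vA x} eq = contradiction (subst (_∈ₛ A) (sym eq) (A∈ x)) (B∩A i (B∈ i y))
    φ-injective {vB i y} {vB i′ y′} eq with i Fin.≟ i′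
    ... | yes refl = cong (vB i) (enumAs-injective (B i) (∣B∣ i) eq)
    ... | no  i≢i′ = contradiction (subst (_∈ₛ B i′) (sym eq) (B∈ i′ y′)) (B∩B i≢i′ (B∈ i y))
    φ-injective {vB k y} {vAij i j x} eq = contradiction (subst (_∈ₛ B k) eq (B∈ k y)) (A′∩B i j k (A′∈ i j x))
    φ-injective {vAij i j x} {vA x′} eq = contradiction (subst (_∈ₛ A) (sym eq) (A∈ x′)) (A′∩A i j (A′∈ i j x))
    φ-injective {vAij i j x} {vB k y} eq = contradiction (subst (_∈ₛ B k) (sym eq) (B∈ k y)) (A′∩B i j k (A′∈ i j x))
    φ-injective {vAij i j x} {vAij i′ j′ x′} eq with (i Fin.≟ i′) ×-dec (j Fin.≟ j′)
    ... | yes (refl , refl) = cong (vAij i j) (enumAs-injective (A′ i j) (∣A′∣ i j) eq)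
    ... | no  ij≢ = contradiction (subst (_∈ₛ A′ i′ j′) (sym eq) (A′∈ i′ j′ x′)) (A′∩A′ ij≢ (A′∈ i j x))
    edge₁ : ∀ i v → (v ∈ₛ A ∪ B i → ∃ λ x → InEdge₁ i x × φ x ≡ v) × ((∃ λ x → InEdge₁ i x × φ x ≡ v) → v ∈ₛ A ∪ B i)
    edge₁ i v = to , from
      where
      to : v ∈ₛ A ∪ B i → ∃ λ x → InEdge₁ i x × φ x ≡ v
      to v∈ with x∈p∪q⁻ A (B i) v∈
      ... | inj₁ v∈A with enumAs-surjective A ∣A∣ v∈A
      ... | x , eq = vA x , tt , eq
      to v∈ | inj₂ v∈B with enumAs-surjective (B i) (∣B∣ i) v∈B
      ... | y , eq = vB i y , refl , eq
      from : (∃ λ x → InEdge₁ i x × φ x ≡ v) → v ∈ₛ A ∪ B i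
      from (vA x    , _    , refl) = x∈p∪q⁺ (inj₁ (A∈ x))
      from (vB i y  , refl , refl) = x∈p∪q⁺ (inj₂ (B∈ i y))
    edge₂ : ∀ i j v → (v ∈ₛ B i ∪ A′ i j → ∃ λ x → InEdge₂ i j x × φ x ≡ v) ×
                        ((∃ λ x → InEdge₂ i j x × φ x ≡ v) → v ∈ₛ B i ∪ A′ i j)
    edge₂ i j v = to , from
      where
      to : v ∈ₛ B i ∪ A′ i j → ∃ λ x → InEdge₂ i j x × φ x ≡ v
      to v∈ with x∈p∪q⁻ (B i) (A′ i j) v∈
      ... | inj₁ v∈B with enumAs-surjective (B i) (∣B∣ i) v∈B
      ... | y , eq = vB i y , refl , eq
      to v∈ | inj₂ v∈A′ with enumAs-surjective (A′ i j) (∣A′∣ i j) v∈A′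
      ... | x , eq = vAij i j x , (refl , refl) , eq
      from : (∃ λ x → InEdge₂ i j x × φ x ≡ v) → v ∈ₛ B i ∪ A′ i j
      from (vB i y     , refl          , refl) = x∈p∪q⁺ (inj₁ (B∈ i y))
      from (vAij i j x , (refl , refl) , refl) = x∈p∪q⁺ (inj₂ (A′∈ i j x))

  -- Two greedy rounds: first the sets B_i around `A`, with cores `K i`, then the sets A_{i,j},
  -- which avoid `A` and every B_i.
  supplies⇒bush : (A : Subset n) → ∣ A ∣ ≡ a → (K : Fin s → Subset n) → (∀ i → ∣ K i ∣ ≤ 1) →
                  (∀ i → Disjoint (K i) A) → (∀ {i j} → i ≢ j → Disjoint (K i) (K j)) →
                  (∀ i → Supply A (K i)) → ContainsBush a b s h H
  supplies⇒bush A ∣A∣≡a K ∣K∣≤1 K∩A K∩K supply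
    with greedy {c = b} (λ _ B → ∣ B ∣ ≡ b × (A ∪ B) ∈ edges H × Extendable B) K A
           (≤-trans (≤-reflexive (cong (_+ s * suc b) ∣A∣≡a)) (m≤m+n _ _)) ∣K∣≤1 K∩A K∩K
           (λ i F F≤ K∩F → let B , ∣B∣≡b , B∩F , AB∈ , ext = supply i F F≤ K∩F in
                           B , (∣B∣≡b , AB∈ , ext) , ≤-reflexive ∣B∣≡b , B∩F)
  ... | B , QB , B∩A , B∩B
    -- A pair `(i , j)` is coded by a single index `t`, decoded by `remQuot`. Nothing needs to be
    -- reserved in this round, so the cores are empty.
    with greedy {c = a} {q = s * h} (λ t A′ → ∣ A′ ∣ ≡ a × (B (proj₁ (remQuot h t)) ∪ A′) ∈ edges H) (λ _ → ⊥ₛ) (A ∪ ⋃ B)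
           room (λ _ → ≤-trans (≤-reflexive (∣⊥∣≡0 n)) z≤n) (λ _ x∈ _ → ∉⊥ x∈) (λ _ x∈ _ → ∉⊥ x∈)
           (λ t F F≤ _ → let A′ , ∣A′∣≡a , A′∩F , BA′∈ = proj₂ (proj₂ (QB (proj₁ (remQuot h t)))) F F≤ in
                         A′ , (∣A′∣≡a , BA′∈) , ≤-reflexive ∣A′∣≡a , A′∩F)
    where
    open ≤-Reasoning
    room : ∣ A ∪ ⋃ B ∣ + s * h * suc a ≤ L
    room = +-monoˡ-≤ (s * h * suc a) (begin
      ∣ A ∪ ⋃ B ∣     ≤⟨ ∣p∪q∣≤∣p∣+∣q∣ A (⋃ B) ⟩
      ∣ A ∣ + ∣ ⋃ B ∣ ≤⟨ +-mono-≤ (≤-reflexive ∣A∣≡a) (∣⋃∣≤ B (λ i → ≤-trans (≤-reflexive (proj₁ (QB i))) (n≤1+n b))) ⟩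
      a + s * suc b   ∎)
  ... | A′ , QA′ , A′∩ , A′∩A′ = assemble ∣A∣≡a (proj₁ ∘ QB) (λ i j → proj₁ (QA′ (combine i j)))
    B∩A B∩B
    (λ i j x∈ x∈A → A′∩ (combine i j) x∈ (x∈p∪q⁺ (inj₁ x∈A)))
    (λ i j k x∈ x∈B → A′∩ (combine i j) x∈ (x∈p∪q⁺ (inj₂ (∈-⋃ B k x∈B))))
    (λ {i} {j} {i′} {j′} ij≢ → A′∩A′ (ij≢ ∘ Fin.combine-injective i j i′ j′))
    (proj₁ ∘ proj₂ ∘ QB)
    (λ i j → subst (λ k → (B k ∪ A′ (combine i j)) ∈ edges H)
               (cong proj₁ (Fin.remQuot-combine i j)) (proj₂ (QA′ (combine i j))))

-- Edges with a centre

module Extraction {n ρ : ℕ} (H : Hypergraph n (2 + ρ)) (a b s h : ℕ) (a+b≡r : a + b ≡ 2 + ρ)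
  (2≤a : 2 ≤ a) (2≤b : 2 ≤ b) (5≤r : 5 ≤ 2 + ρ) (no-bush : ¬ ContainsBush a b s h H) where

  open Bush H a b s h

  private
    r = 2 + ρ

  1≤L : 1 ≤ L
  1≤L = ≤-trans (≤-trans (n≤1+n 1) 2≤a) (≤-trans (m≤m+n a (s * suc b)) (m≤m+n _ _))

  module _ (G : List (Subset n)) (G-unique : Unique G) (G⊆H : ∀ {e} → e ∈ G → e ∈ edges H) where

    edge : Fin (length G) → Subset n
    edge = lookup G

    ∣edge∣ : ∀ x → ∣ edge x ∣ ≡ r
    ∣edge∣ x = All.lookup (uniform H) (G⊆H (∈-lookup x))

    -- Position `i` of an edge holds its `i`-th smallest vertex, so that an edge is recovered from
    -- its tuple; no partition of the vertex set is involved.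
    v : Fin (length G) → Fin r → Fin n
    v x = enumAs (edge x) (∣edge∣ x)

    v∈ : ∀ x i → v x i ∈ₛ edge x
    v∈ x = enumAs-∈ (edge x) (∣edge∣ x)

    v-ext : ∀ {x y} → (∀ i → v x i ≡ v y i) → x ≡ y
    v-ext {x} {y} eq = lookup-injective G-unique (⊆-antisym (sub eq) (sub (sym ∘ eq)))
      where
      sub : ∀ {x y} → (∀ i → v x i ≡ v y i) → edge x ⊆ₛ edge y
      sub {x} {y} eq u∈ with enumAs-surjective (edge x) (∣edge∣ x) u∈
      ... | i , refl = subst (_∈ₛ edge y) (sym (eq i)) (v∈ y i)

    open Positions L v

    ∣minus∣ : ∀ {S x k l} → S ⊆ₛ edge x → ∣ S ∣ ≡ k → k + l ≡ r → ∣ edge x ∩ ∁ S ∣ ≡ l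
    ∣minus∣ {S} {x} {k} {l} S⊆ ∣S∣ k+l = +-cancelˡ-≡ k _ l
      (trans (cong (_+ ∣ edge x ∩ ∁ S ∣) (sym ∣S∣)) (trans (q⊆p⇒∣q∣+∣p∩∁q∣≡∣p∣ S⊆) (trans (∣edge∣ x) (sym k+l))))

    -- `Q` may contain more than the positions of `S`. Positions outside `Q` are moved off `F` by
    -- flexibility; those in `Q` but not in `S` keep their vertices, which must therefore avoid `F`
    -- from the start.
    extend : ∀ {G′ x Q S F} → Flex Q G′ x → S ⊆ₛ edge x → (∀ i → v x i ∈ₛ S → i ∈ₛ Q) →
             ∣ F ∣ ≤ L → (∀ i → i ∈ₛ Q → v x i ∉ₛ S → v x i ∉ₛ F) →
             ∃ λ y → y ∈ G′ × Agree Q x y × S ⊆ₛ edge y × Disjoint (edge y ∩ ∁ S) F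
    extend {x = x} {Q} {S} {F} flex S⊆x S⇒Q F≤ Q⇒S with flex F F≤
    ... | y , y∈ , ag , avoid = y , y∈ , ag , S⊆y , disjoint
      where
      S⊆y : S ⊆ₛ edge y
      S⊆y u∈S with enumAs-surjective (edge x) (∣edge∣ x) (S⊆x u∈S)
      ... | i , refl = subst (_∈ₛ edge y) (sym (ag i (S⇒Q i u∈S))) (v∈ y i)
      disjoint : Disjoint (edge y ∩ ∁ S) F
      disjoint u∈ u∈F with ∈-minus⁻ {p = edge y} u∈
      ... | u∈y , u∉S with enumAs-surjective (edge y) (∣edge∣ y) u∈y
      ... | i , refl with i ∈? Q
      ... | no  i∉Q = avoid i i∉Q u∈F
      ... | yes i∈Q = Q⇒S i i∈Q (subst (_∉ₛ S) (sym (ag i i∈Q)) u∉S) (subst (_∈ₛ F) (sym (ag i i∈Q)) u∈F)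

    extendable : ∀ {G′ x Q B} → Flex Q G′ x → B ⊆ₛ edge x → ∣ B ∣ ≡ b →
                 (∀ i → v x i ∈ₛ B → i ∈ₛ Q) → (∀ i → i ∈ₛ Q → v x i ∈ₛ B) → Extendable B
    extendable flex B⊆ ∣B∣ B⇒Q Q⇒B F F≤ with extend flex B⊆ B⇒Q F≤ (λ i i∈ i∉ → contradiction (Q⇒B i i∈) i∉)
    ... | y , _ , _ , B⊆y , disjoint = edge y ∩ ∁ _ , ∣minus∣ B⊆y ∣B∣ (trans (+-comm b a) a+b≡r) , disjoint ,
      subst (_∈ edges H) (sym (∪-minus B⊆y)) (G⊆H (∈-lookup y))

    module _ {G′ : List (Fin (length G))} where

      -- Fix the vertices of `A` and the centre, and move the others off `F`. In the new edge `y`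
      -- the set `B`, the complement of `A`, contains the vertex at the centre position `i`, so its
      -- position set is flexible again and `B` is extendable.
      centre⇒supply : ∀ {i x} → (∀ P → i ∈ₛ P → ∀ {x} → x ∈ G′ → Flex P G′ x) → x ∈ G′ →
                      ∀ A → ∣ A ∣ ≡ a → A ⊆ₛ edge x → v x i ∉ₛ A → Supply A ⁅ v x i ⁆
      centre⇒supply {i} {x} flexible x∈ A ∣A∣ A⊆x w∉A F F≤ w∩F
        with extend (flexible Q (x∈p∪q⁺ (inj₂ (x∈⁅x⁆ i))) x∈) A⊆x
               (λ j j∈ → x∈p∪q⁺ (inj₁ (∈-select⁺ (λ j → v x j ∈? A) j∈))) F≤ new∉F
        where
        Q = select (λ j → v x j ∈? A) ∪ ⁅ i ⁆
        new∉F : ∀ j → j ∈ₛ Q → v x j ∉ₛ A → v x j ∉ₛ F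
        new∉F j j∈ ∉A with x∈p∪q⁻ (select (λ j → v x j ∈? A)) ⁅ i ⁆ j∈
        ... | inj₁ j∈A = contradiction (∈-select⁻ (λ j → v x j ∈? A) j∈A) ∉A
        ... | inj₂ j∈i with x∈⁅y⁆⇒x≡y i j∈i
        ... | refl = w∩F (x∈⁅x⁆ (v x i))
      ... | y , y∈ , ag , A⊆y , disjoint = B , ∣minus∣ A⊆y ∣A∣ a+b≡r , disjoint ,
        subst (_∈ edges H) (sym (∪-minus A⊆y)) (G⊆H (∈-lookup y)) ,
        extendable (flexible (select (λ j → v y j ∈? B)) (∈-select⁺ (λ j → v y j ∈? B) i∈) y∈)
          (p∩q⊆p (edge y) (∁ A)) (∣minus∣ A⊆y ∣A∣ a+b≡r)
          (λ j → ∈-select⁺ (λ j → v y j ∈? B)) (λ j → ∈-select⁻ (λ j → v y j ∈? B))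
        where
        B = edge y ∩ ∁ A
        i∈ : v y i ∈ₛ B
        i∈ = ∈-minus⁺ (v∈ y i) (subst (_∉ₛ A) (ag i (x∈p∪q⁺ (inj₂ (x∈⁅x⁆ i)))) w∉A)

      -- `A` consists of the vertices of `x` at the positions `P`. An edge that agrees with `x` on
      -- `P` has `A` at these same positions, so its remainder `B` sits exactly at `∁ P` and is
      -- extendable by the second flexibility.
      split⇒supply : ∀ {P x} (∣P∣ : ∣ P ∣ ≡ a) → (∀ {x} → x ∈ G′ → Flex P G′ x) → (∀ {x} → x ∈ G′ → Flex (∁ P) G′ x) →
                     x ∈ G′ → ∃ λ A → ∣ A ∣ ≡ a × Supply A ⊥ₛ
      split⇒supply {P} {x} ∣P∣ flexP flex∁P x∈ = A , ∣image∣ f f-injective , supply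
        where
        f : Fin a → Fin n
        f = v x ∘ enumAs P ∣P∣
        f-injective : Injective _≡_ _≡_ f
        f-injective = enumAs-injective P ∣P∣ ∘ enumAs-injective (edge x) (∣edge∣ x)
        A = image f
        A⇒P : ∀ i → v x i ∈ₛ A → i ∈ₛ P
        A⇒P i vi∈ with ∈-image⁻ f vi∈
        ... | j , eq = subst (_∈ₛ P) (enumAs-injective (edge x) (∣edge∣ x) eq) (enumAs-∈ P ∣P∣ j)
        P⇒A : ∀ i → i ∈ₛ P → v x i ∈ₛ A
        P⇒A i i∈P with enumAs-surjective P ∣P∣ i∈P
        ... | j , refl = ∈-image⁺ f j
        A⊆x : A ⊆ₛ edge x
        A⊆x u∈ with ∈-image⁻ f u∈
        ... | j , refl = v∈ x _
        supply : Supply A ⊥ₛ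
        supply F F≤ _ with extend (flexP x∈) A⊆x A⇒P F≤ (λ i i∈ i∉ → contradiction (P⇒A i i∈) i∉)
        ... | y , y∈ , ag , A⊆y , disjoint = edge y ∩ ∁ A , ∣minus∣ A⊆y ∣A∣ a+b≡r , disjoint ,
          subst (_∈ edges H) (sym (∪-minus A⊆y)) (G⊆H (∈-lookup y)) ,
          extendable (flex∁P y∈) (p∩q⊆p (edge y) (∁ A)) (∣minus∣ A⊆y ∣A∣ a+b≡r)
            (λ i vi∈ → x∉p⇒x∈∁p λ i∈P → proj₂ (∈-minus⁻ {p = edge y} vi∈) (subst (_∈ₛ A) (ag i i∈P) (P⇒A i i∈P)))
            (λ i i∈∁P → ∈-minus⁺ (v∈ y i) λ vi∈A → x∈∁p⇒x∉p i∈∁P (in-P i vi∈A))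
          where
          ∣A∣ = ∣image∣ f f-injective
          in-P : ∀ i → v y i ∈ₛ A → i ∈ₛ P
          in-P i vi∈A with enumAs-surjective (edge x) (∣edge∣ x) (A⊆x vi∈A)
          ... | k , eq = subst (_∈ₛ P) (enumAs-injective (edge y) (∣edge∣ y) (trans (sym (ag k k∈P)) eq)) k∈P
            where k∈P = A⇒P k (subst (_∈ₛ A) (sym eq) vi∈A)

    -- A homogeneous subfamily has a central position or a flexible split; the first makes each of
    -- its edges centred, the second would produce a bush.
    extract : loss r L * n ^ ρ < length G →
              ∃₂ λ e w → e ∈ G × w ∈ₛ e × (∀ A → ∣ A ∣ ≡ a → A ⊆ₛ e → w ∉ₛ A → Supply A ⁅ w ⁆)
    extract big = fromHomogeneous
      (homogeneousAll (n ^ ρ) (allFin (length G)) (Unique.allFin⁺ (length G))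
        (≤-trans big (≤-reflexive (sym (length-tabulate {n = length G} id)))))
      where
      fromHomogeneous : (∃ λ G′ → (∀ {x} → x ∈ G′ → x ∈ allFin (length G)) × Unique G′ × n ^ ρ < length G′ ×
                                  (∀ P → FlexOrDetermined G′ P)) →
                        ∃₂ λ e w → e ∈ G × w ∈ₛ e × (∀ A → ∣ A ∣ ≡ a → A ⊆ₛ e → w ∉ₛ A → Supply A ⁅ w ⁆)
      fromHomogeneous (G′ , _ , G′-unique , G′-big , fd) =
        [ fromCentre , ⊥-elim ∘ fromSplit ]′ (centreOrSplit a b a+b≡r 2≤a 2≤b 5≤r)
        where
        open Homogeneous L 1≤L v v-ext G′ G′-unique G′-big fd
        x = lookup G′ (fromℕ< G′-big)
        x∈ : x ∈ G′
        x∈ = ∈-lookup (fromℕ< G′-big)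
        fromCentre : (∃ λ i → ∀ P → i ∈ₛ P → Flexible P) →
                     ∃₂ λ e w → e ∈ G × w ∈ₛ e × (∀ A → ∣ A ∣ ≡ a → A ⊆ₛ e → w ∉ₛ A → Supply A ⁅ w ⁆)
        fromCentre (i , flex) = edge x , v x i , ∈-lookup x , v∈ x i , centre⇒supply flex x∈
        fromSplit : (∃ λ P → ∣ P ∣ ≡ a × Flexible P × Flexible (∁ P)) → ⊥
        fromSplit (P , ∣P∣ , flexP , flex∁P) =
          let A , ∣A∣ , supply = split⇒supply ∣P∣ flexP flex∁P x∈ in
          -- The same supply serves all `s` branches, because the empty cores are trivially
          -- disjoint.
          no-bush (supplies⇒bush A ∣A∣ (λ _ → ⊥ₛ) (λ _ → ≤-trans (≤-reflexive (∣⊥∣≡0 n)) z≤n)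
                    (λ _ x∈ _ → ∉⊥ x∈) (λ _ x∈ _ → ∉⊥ x∈) (λ _ → supply))

  Centred : Subset n → Fin n → Set
  Centred e w = w ∈ₛ e × (∀ A → ∣ A ∣ ≡ a → A ⊆ₛ e → w ∉ₛ A → Supply A ⁅ w ⁆)

  record Centring (G : List (Subset n)) : Set where
    field
      marks        : List (Subset n × Fin n)
      marks-unique : Unique (map proj₁ marks)
      marked       : ∀ {e w} → (e , w) ∈ marks → e ∈ G × Centred e w
      length≤      : length G ≤ length marks + loss r L * n ^ ρ

  open Centring

  centre : ∀ {G e w} → Unique G → e ∈ G → Centred e w → Centring (filter (λ e′ → ¬? (e′ ≟ₛ e)) G) → Centring G
  centre {G} {e} {w} G-unique e∈G centred rest = record
    { marks        = (e , w) ∷ marks rest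
    ; marks-unique = All.tabulate fresh ∷ marks-unique rest
    ; marked       = marked′
    ; length≤      = length≤′
    }
    where
    others : List (Subset n)
    others = filter (λ e′ → ¬? (e′ ≟ₛ e)) G
    rest⁻ : ∀ {e′ w′} → (e′ , w′) ∈ marks rest → e′ ∈ G × e′ ≢ e
    rest⁻ m∈ = ∈-filter⁻ (λ e′ → ¬? (e′ ≟ₛ e)) {xs = G} (proj₁ (marked rest m∈))
    fresh : ∀ {e′} → e′ ∈ map proj₁ (marks rest) → e ≢ e′
    fresh e′∈ eq = let (_ , _) , m∈ , e′≡ = ∈-map⁻ proj₁ e′∈ in proj₂ (rest⁻ m∈) (trans (sym e′≡) (sym eq))
    marked′ : ∀ {e′ w′} → (e′ , w′) ∈ (e , w) ∷ marks rest → e′ ∈ G × Centred e′ w′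
    marked′ (here refl) = e∈G , centred
    marked′ (there m∈)  = proj₁ (rest⁻ m∈) , proj₂ (marked rest m∈)
    length≤′ : length G ≤ suc (length (marks rest)) + loss r L * n ^ ρ
    length≤′ = begin
      length G                                    ≡⟨ length-filter-¬ (_≟ₛ e) G ⟨
      length (filter (_≟ₛ e) G) + length others
        ≤⟨ +-mono-≤ (unique⊆⇒length≤ {ys = e ∷ []} (Unique.filter⁺ (_≟ₛ e) G-unique)
                       (λ x∈ → here (proj₂ (∈-filter⁻ (_≟ₛ e) {xs = G} x∈)))) (length≤ rest) ⟩
      suc (length (marks rest) + loss r L * n ^ ρ) ∎
      where open ≤-Reasoning

  -- While more than `loss r L * n ^ ρ` edges remain, `extract` finds a centred one among them; it
  -- is marked and removed. `N` bounds the number of rounds.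
  centring : ∀ N G → length G ≤ N → Unique G → (∀ {e} → e ∈ G → e ∈ edges H) → Centring G
  centring N G G≤N G-unique G⊆H with loss r L * n ^ ρ ℕ.<? length G
  ... | no ≮ = record { marks = [] ; marks-unique = [] ; marked = λ () ; length≤ = ≮⇒≥ ≮ }
  centring zero    [] _   _        _   | yes ()
  centring (suc N) G  G≤N G-unique G⊆H | yes big =
    let e , w , e∈G , centred = extract G G-unique G⊆H big in
    centre G-unique e∈G centred
      (centring N (filter (λ e′ → ¬? (e′ ≟ₛ e)) G)
        (s≤s⁻¹ (≤-trans (filter-notAll (λ e′ → ¬? (e′ ≟ₛ e)) G (lose e∈G (λ ≢ → ≢ refl))) G≤N))
        (Unique.filter⁺ (λ e′ → ¬? (e′ ≟ₛ e)) G-unique)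
        (G⊆H ∘ proj₁ ∘ ∈-filter⁻ (λ e′ → ¬? (e′ ≟ₛ e))))

-- Counting tuples

tuples : (n k : ℕ) → List (Vec (Fin n) k)
tuples n = words (allFin n)

length-allFin : (n : ℕ) → length (allFin n) ≡ n
length-allFin n = length-tabulate {n = n} id

length-tuples : (n k : ℕ) → length (tuples n k) ≡ n ^ k
length-tuples n k = trans (length-words k) (cong (_^ k) (length-allFin n))

∑-tuples : (n k : ℕ) (g : Vec (Fin n) (suc k) → ℕ) →
           ∑ (tuples n (suc k)) g ≡ ∑ (allFin n) (λ x → ∑ (tuples n k) (λ t → g (x ∷ t)))
∑-tuples n k g = ∑-cartesianProductWith _∷_ (allFin n) (tuples n k) g

∑-allFin-const : (n c : ℕ) → ∑ (allFin n) (λ _ → c) ≡ n * c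
∑-allFin-const n c = trans (∑-const (allFin n) c) (cong (_* c) (length-allFin n))

-- Almost constant functions on tuples

Adjacent : Vec (Fin n) k → Vec (Fin n) k → Set
Adjacent t t′ = ∃ λ i → ∀ j → i ≢ j → Vec.lookup t j ≡ Vec.lookup t′ j

module _ {V : Set} (_≟_ : DecidableEquality V) where

  exceptional? : {Bad : Vec (Fin n) k → Set} → Decidable Bad → (f : Vec (Fin n) k → V) (c : V) →
                 Decidable (λ t → Bad t ⊎ f t ≢ c)
  exceptional? bad? f c t = bad? t ⊎-dec ¬? (f t ≟ c)

  -- Slicing along the first coordinate: in the slice z with the fewest bad tuples the claim holds by
  -- induction, and (x ∷ t) agrees with (z ∷ t) unless one of them is bad.
  majority : 0 < n → ∀ k {Bad : Vec (Fin n) k → Set} (bad? : Decidable Bad) (f : Vec (Fin n) k → V) →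
             (∀ {t t′} → Adjacent t t′ → ¬ Bad t → ¬ Bad t′ → f t ≡ f t′) →
             ∃ λ c → ∑ (tuples n k) (ind ∘ exceptional? bad? f c) ≤ suc k * ∑ (tuples n k) (ind ∘ bad?)
  majority 0<n zero bad? f _ = f [] , ≤-trans
    (+-monoˡ-≤ 0 (ind≤ (exceptional? bad? f (f []) [])
      [ (λ b → ≤-reflexive (sym (ind-yes (bad? []) b))) , (λ ≢ → contradiction refl ≢) ]′))
    (≤-reflexive (sym (*-identityˡ _)))
  majority {n} 0<n (suc k) {Bad} bad? f inv = c , (begin
    ∑ (tuples n (suc k)) (ind ∘ exceptional? bad? f c)
      ≤⟨ ∑-mono (tuples n (suc k)) (λ {t} _ → pointwise t) ⟩
    ∑ (tuples n (suc k)) (λ t → ind (bad? t) + ind (slice-exc? (Vec.tail t)))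
      ≡⟨ ∑-+ (tuples n (suc k)) (ind ∘ bad?) (ind ∘ slice-exc? ∘ Vec.tail) ⟩
    β + ∑ (tuples n (suc k)) (ind ∘ slice-exc? ∘ Vec.tail)
      ≡⟨ cong (β +_) (trans (∑-tuples n k (ind ∘ slice-exc? ∘ Vec.tail)) (∑-allFin-const n _)) ⟩
    β + n * ∑ (tuples n k) (ind ∘ slice-exc?)
      ≤⟨ +-monoʳ-≤ β (*-monoʳ-≤ n (proj₂ ih)) ⟩
    β + n * (suc k * slice z)
      ≡⟨ cong (β +_) (trans (sym (*-assoc n (suc k) (slice z)))
           (trans (cong (_* slice z) (*-comm n (suc k))) (*-assoc (suc k) n (slice z)))) ⟩
    β + suc k * (n * slice z)
      ≤⟨ +-monoʳ-≤ β (*-monoʳ-≤ (suc k) slice-small) ⟩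
    β + suc k * β ∎)
    where
    open ≤-Reasoning
    β = ∑ (tuples n (suc k)) (ind ∘ bad?)
    slice : Fin n → ℕ
    slice x = ∑ (tuples n k) (λ t → ind (bad? (x ∷ t)))
    least : ∃ λ z → z ∈ allFin n × length (allFin n) * slice z ≤ ∑ (allFin n) slice
    least = min≤average (allFin n) slice (≤-trans 0<n (≤-reflexive (sym (length-allFin n))))
    z = proj₁ least
    slice-small : n * slice z ≤ β
    slice-small = begin
      n * slice z                  ≡⟨ cong (_* slice z) (length-allFin n) ⟨
      length (allFin n) * slice z  ≤⟨ proj₂ (proj₂ least) ⟩
      ∑ (allFin n) slice           ≡⟨ ∑-tuples n k (ind ∘ bad?) ⟨
      β                            ∎
    adjacent-∷ : ∀ {t t′} → Adjacent t t′ → Adjacent (z ∷ t) (z ∷ t′)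
    adjacent-∷ (i , same) = suc i , λ { zero _ → refl ; (suc j) i≢j → same j (i≢j ∘ cong suc) }
    ih : ∃ λ c → ∑ (tuples n k) (ind ∘ exceptional? (λ t → bad? (z ∷ t)) (λ t → f (z ∷ t)) c) ≤ suc k * slice z
    ih = majority 0<n k (λ t → bad? (z ∷ t)) (λ t → f (z ∷ t)) (inv ∘ adjacent-∷)
    c = proj₁ ih
    slice-exc? : Decidable (λ t → Bad (z ∷ t) ⊎ f (z ∷ t) ≢ c)
    slice-exc? = exceptional? (λ t → bad? (z ∷ t)) (λ t → f (z ∷ t)) c
    pointwise : ∀ t → ind (exceptional? bad? f c t) ≤ ind (bad? t) + ind (slice-exc? (Vec.tail t))
    pointwise (x ∷ t) with bad? (x ∷ t)
    ... | yes _ = s≤s z≤n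
    ... | no good = ind≤ (no good ⊎-dec ¬? (f (x ∷ t) ≟ c)) λ
      { (inj₁ bad) → contradiction bad good
      ; (inj₂ ≢c)  → ≤-reflexive (sym (ind-yes (slice-exc? t) (slice-exceptional ≢c))) }
      where
      slice-exceptional : f (x ∷ t) ≢ c → Bad (z ∷ t) ⊎ f (z ∷ t) ≢ c
      slice-exceptional ≢c with bad? (z ∷ t)
      ... | yes bad = inj₁ bad
      ... | no  good′ = inj₂ (≢c ∘ trans
        (inv (zero , λ { zero 0≢0 → contradiction refl 0≢0 ; (suc j) _ → refl }) good good′))

-- Repeated entries and tuples inside a set

occurrences : Fin n → Vec (Fin n) k → ℕ
occurrences x []      = 0
occurrences x (y ∷ t) = ind (x Fin.≟ y) + occurrences x t

-- The number of pairs of equal coordinates. Counting the pairs, instead of only asking whether one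
-- exists, makes the sum over all tuples additive.
repetitions : Vec (Fin n) k → ℕ
repetitions []      = 0
repetitions (x ∷ t) = occurrences x t + repetitions t

occurrences≡0 : (x : Fin n) (t : Vec (Fin n) k) → occurrences x t ≡ 0 → ∀ j → x ≢ Vec.lookup t j
occurrences≡0 x (y ∷ t) eq zero refl = contradiction (trans (sym (ind-yes (x Fin.≟ x) refl)) (m+n≡0⇒m≡0 _ eq)) λ ()
occurrences≡0 x (y ∷ t) eq (suc j) = occurrences≡0 x t (m+n≡0⇒n≡0 (ind (x Fin.≟ y)) eq) j

repetitions≡0⇒injective : (t : Vec (Fin n) k) → repetitions t ≡ 0 → Injective _≡_ _≡_ (Vec.lookup t)
repetitions≡0⇒injective (x ∷ t) eq {zero}  {zero}  _   = refl
repetitions≡0⇒injective (x ∷ t) eq {zero}  {suc j} x≡  = contradiction x≡ (occurrences≡0 x t (m+n≡0⇒m≡0 _ eq) j)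
repetitions≡0⇒injective (x ∷ t) eq {suc i} {zero}  ≡x  = contradiction (sym ≡x) (occurrences≡0 x t (m+n≡0⇒m≡0 _ eq) i)
repetitions≡0⇒injective (x ∷ t) eq {suc i} {suc j} ≡   =
  cong suc (repetitions≡0⇒injective t (m+n≡0⇒n≡0 (occurrences x t) eq) ≡)

-- Each of the `k` coordinates equals `x` in a proportion 1/n of the tuples. The factor `n` on the
-- left avoids the exponent `k - 1`; the same form is used for `∑-repetitions`.
∑-occurrences : (k : ℕ) (x : Fin n) → n * ∑ (tuples n k) (occurrences x) ≤ k * n ^ k
∑-occurrences {n} zero    x = ≤-reflexive (*-zeroʳ n)
∑-occurrences {n} (suc k) x = begin
  n * ∑ (tuples n (suc k)) (occurrences x)
    ≡⟨ cong (n *_) (∑-tuples n k (occurrences x)) ⟩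
  n * ∑ (allFin n) (λ y → ∑ (tuples n k) (λ t → ind (x Fin.≟ y) + occurrences x t))
    ≡⟨ cong (n *_) (∑-cong (allFin n) λ y → trans (∑-+ (tuples n k) (λ _ → ind (x Fin.≟ y)) (occurrences x))
         (cong (_+ o) (trans (∑-const (tuples n k) _)
           (trans (cong (_* ind (x Fin.≟ y)) (length-tuples n k)) (*-comm (n ^ k) _))))) ⟩
  n * ∑ (allFin n) (λ y → ind (x Fin.≟ y) * n ^ k + o)
    ≡⟨ cong (n *_) (trans (∑-+ (allFin n) (λ y → ind (x Fin.≟ y) * n ^ k) (λ _ → o))
         (cong₂ _+_ (∑-* (allFin n) (λ y → ind (x Fin.≟ y)) (n ^ k)) (∑-allFin-const n o))) ⟩
  n * (∑ (allFin n) (λ y → ind (x Fin.≟ y)) * n ^ k + n * o)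
    ≤⟨ *-monoʳ-≤ n (+-mono-≤ (*-monoˡ-≤ (n ^ k) once) (∑-occurrences k x)) ⟩
  n * (1 * n ^ k + k * n ^ k) ≡⟨ arith n k (n ^ k) ⟩
  suc k * n ^ suc k ∎
  where
  open ≤-Reasoning
  open +-*-Solver
  o = ∑ (tuples n k) (occurrences x)
  arith : ∀ n k p → n * (1 * p + k * p) ≡ suc k * (n * p)
  arith = solve 3 (λ n k p → n :* (con 1 :* p :+ k :* p) := (con 1 :+ k) :* (n :* p)) refl
  once : ∑ (allFin n) (λ y → ind (x Fin.≟ y)) ≤ 1
  once = ≤-trans (≤-reflexive (∑-ind (x Fin.≟_) (allFin n)))
    (unique⊆⇒length≤ {ys = x ∷ []} (Unique.filter⁺ (x Fin.≟_) (Unique.allFin⁺ n))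
      (λ y∈ → here (sym (proj₂ (∈-filter⁻ (x Fin.≟_) {xs = allFin n} y∈)))))

∑-repetitions : (k : ℕ) → n * ∑ (tuples n k) repetitions ≤ k * k * n ^ k
∑-repetitions {n} zero    = ≤-reflexive (*-zeroʳ n)
∑-repetitions {n} (suc k) = begin
  n * ∑ (tuples n (suc k)) repetitions
    ≡⟨ cong (n *_) (∑-tuples n k repetitions) ⟩
  n * ∑ (allFin n) (λ x → ∑ (tuples n k) (λ t → occurrences x t + repetitions t))
    ≡⟨ cong (n *_) (trans (∑-cong (allFin n) (λ x → ∑-+ (tuples n k) (occurrences x) repetitions))
         (trans (∑-+ (allFin n) (λ x → ∑ (tuples n k) (occurrences x)) (λ _ → R))
           (cong (∑ (allFin n) O +_) (∑-allFin-const n R)))) ⟩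
  n * (∑ (allFin n) O + n * R)
    ≡⟨ *-distribˡ-+ n (∑ (allFin n) O) (n * R) ⟩
  n * ∑ (allFin n) O + n * (n * R)
    ≤⟨ +-mono-≤ O≤ (*-monoʳ-≤ n (∑-repetitions k)) ⟩
  n * (k * n ^ k) + n * (k * k * n ^ k)
    -- The added term completes the coefficient `k + k * k` to `suc k * suc k`.
    ≤⟨ m≤m+n _ (suc k * (n * n ^ k)) ⟩
  n * (k * n ^ k) + n * (k * k * n ^ k) + suc k * (n * n ^ k)
    ≡⟨ arith n k (n ^ k) ⟩
  suc k * suc k * n ^ suc k ∎
  where
  open ≤-Reasoning
  open +-*-Solver
  R = ∑ (tuples n k) repetitions
  O : Fin n → ℕ
  O x = ∑ (tuples n k) (occurrences x)
  arith : ∀ n k p → n * (k * p) + n * (k * k * p) + suc k * (n * p) ≡ suc k * suc k * (n * p)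
  arith = solve 3 (λ n k p → n :* (k :* p) :+ n :* (k :* k :* p) :+ (con 1 :+ k) :* (n :* p)
                            := (con 1 :+ k) :* (con 1 :+ k) :* (n :* p)) refl
  O≤ : n * ∑ (allFin n) O ≤ n * (k * n ^ k)
  O≤ = begin
    n * ∑ (allFin n) O                ≡⟨ *-comm n _ ⟩
    ∑ (allFin n) O * n                ≡⟨ ∑-* (allFin n) O n ⟨
    ∑ (allFin n) (λ x → O x * n)
      ≤⟨ ∑-mono (allFin n) (λ {x} _ → ≤-trans (≤-reflexive (*-comm (O x) n)) (∑-occurrences k x)) ⟩
    ∑ (allFin n) (λ _ → k * n ^ k)    ≡⟨ ∑-allFin-const n _ ⟩
    n * (k * n ^ k)                   ∎

-- The indicator that all entries lie in `S`, written as a product so that its sum over tuples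
-- factorises.
within : Subset n → Vec (Fin n) k → ℕ
within S []      = 1
within S (x ∷ t) = ind (x ∈? S) * within S t

within≥1 : (S : Subset n) (t : Vec (Fin n) k) → (∀ j → Vec.lookup t j ∈ₛ S) → 1 ≤ within S t
within≥1 S []      _  = ≤-refl
within≥1 S (x ∷ t) ∈S = *-mono-≤ (≤-reflexive (sym (ind-yes (x ∈? S) (∈S zero)))) (within≥1 S t (∈S ∘ suc))

∑-within : (k : ℕ) (S : Subset n) → ∑ (tuples n k) (within S) ≤ ∣ S ∣ ^ k
∑-within zero        S = ≤-refl
∑-within {n} (suc k) S = begin
  ∑ (tuples n (suc k)) (within S)
    ≡⟨ ∑-tuples n k (within S) ⟩
  ∑ (allFin n) (λ x → ∑ (tuples n k) (λ t → ind (x ∈? S) * within S t))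
    ≡⟨ ∑-cong (allFin n) (λ x → trans (∑-cong (tuples n k) (λ t → *-comm (ind (x ∈? S)) (within S t)))
         (trans (∑-* (tuples n k) (within S) (ind (x ∈? S))) (*-comm _ (ind (x ∈? S))))) ⟩
  ∑ (allFin n) (λ x → ind (x ∈? S) * ∑ (tuples n k) (within S))
    ≡⟨ ∑-* (allFin n) (λ x → ind (x ∈? S)) _ ⟩
  ∑ (allFin n) (λ x → ind (x ∈? S)) * ∑ (tuples n k) (within S)
    ≤⟨ *-mono-≤ size≤ (∑-within k S) ⟩
  ∣ S ∣ ^ suc k ∎
  where
  open ≤-Reasoning
  size≤ : ∑ (allFin n) (λ x → ind (x ∈? S)) ≤ ∣ S ∣
  size≤ = ≤-trans (≤-reflexive (∑-ind (_∈? S) (allFin n)))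
    (≤-trans (unique⊆⇒length≤ (Unique.filter⁺ (_∈? S) (Unique.allFin⁺ n)) listed)
             (≤-reflexive (length-tabulate (enum S))))
    where
    listed : ∀ {x} → x ∈ filter (_∈? S) (allFin n) → x ∈ List.tabulate (enum S)
    listed x∈ with enum-surjective S (proj₂ (∈-filter⁻ (_∈? S) {xs = allFin n} x∈))
    ... | i , refl = ∈-tabulate⁺ i

length-concatMap : {A B : Set} (f : A → List B) (xs : List A) → length (concatMap f xs) ≡ ∑ xs (length ∘ f)
length-concatMap f []       = refl
length-concatMap f (x ∷ xs) = trans (length-++ (f x)) (cong (length (f x) +_) (length-concatMap f xs))

term≤∑ : {A : Set} (xs : List A) (g : A → ℕ) {x : A} → x ∈ xs → g x ≤ ∑ xs g
term≤∑ (x ∷ xs) g (here refl) = m≤m+n (g x) _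
term≤∑ (x ∷ xs) g (there x∈)  = ≤-trans (term≤∑ xs g x∈) (m≤n+m _ (g x))

∃-filter-¬ : {A : Set} {P : A → Set} (P? : Decidable P) (xs : List A) → length (filter P? xs) < length xs →
             ∃ λ x → x ∈ xs × ¬ P x
∃-filter-¬ P? xs fewer with All.search P? xs
... | inj₁ all¬ = lookup xs x , ∈-lookup x , All.lookup all¬ (∈-lookup x)
  where x = fromℕ< (≤-trans (s≤s z≤n) fewer)
... | inj₂ _ with Any.any? (¬? ∘ P?) xs
... | yes any = find any
... | no none = contradiction fewer (<-irrefl (cong length
      (filter-all P? (All.tabulate λ {x} x∈ → decidable-stable (P? x) (none ∘ lose x∈)))))

∪⁅⁆-minus : {S : Subset n} {w : Fin n} → w ∉ₛ S → (S ∪ ⁅ w ⁆) ∩ ∁ ⁅ w ⁆ ≡ S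
∪⁅⁆-minus {S = S} {w} w∉S = ⊆-antisym
  (λ x∈ → let x∈∪ , x∉w = ∈-minus⁻ {p = S ∪ ⁅ w ⁆} x∈ in [ id , (λ x∈w → contradiction x∈w x∉w) ]′ (x∈p∪q⁻ S ⁅ w ⁆ x∈∪))
  (λ x∈ → ∈-minus⁺ (x∈p∪q⁺ (inj₁ x∈)) (λ x∈w → w∉S (subst (_∈ₛ S) (x∈⁅y⁆⇒x≡y w x∈w) x∈)))

minus-∪⁅⁆ : {e : Subset n} {w : Fin n} → w ∈ₛ e → (e ∩ ∁ ⁅ w ⁆) ∪ ⁅ w ⁆ ≡ e
minus-∪⁅⁆ {e = e} {w} w∈e = trans (∪-comm (e ∩ ∁ ⁅ w ⁆) ⁅ w ⁆)
  (∪-minus λ x∈ → subst (_∈ₛ e) (sym (x∈⁅y⁆⇒x≡y w x∈)) w∈e)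

opaque
  -- With `k = r - 1`: the factor `suc k` is the loss in `majority`, `k * k` accounts for tuples
  -- with repetitions, and `d * k ^ k` for the orderings of at most `d * n ^ (k - 1)` deficient
  -- sets.
  exceptionBound : ℕ → ℕ → ℕ
  exceptionBound k d = suc k * (k * k + d * k ^ k)

  exceptionBound≥1 : ∀ k d → 1 ≤ exceptionBound (suc k) d
  exceptionBound≥1 k d = s≤s z≤n

  exceptionBound-* : ∀ k d p → suc k * ((k * k + d * k ^ k) * p) ≡ exceptionBound k d * p
  exceptionBound-* k d p = sym (*-assoc (suc k) (k * k + d * k ^ k) p)

-- Concentration of the centres

-- From here on the bush has `suc s` sets B_i, so `s` is the number of vertices of high degree
-- sought, and `ρ = r - 2`.
module Concentration {n ρ : ℕ} (0<n : 0 < n) (H : Hypergraph n (2 + ρ)) (a b s h : ℕ) (a≤ρ : a ≤ ρ)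
  (no-bush : ¬ ContainsBush a b (suc s) h H)
  (M : List (Subset n × Fin n)) (M-unique : Unique (map proj₁ M))
  (M⊆ : ∀ {e w} → (e , w) ∈ M → e ∈ edges H × w ∈ₛ e × (∀ A → ∣ A ∣ ≡ a → A ⊆ₛ e → w ∉ₛ A →
    Bush.Supply H a b (suc s) h A ⁅ w ⁆))
  where

  open Bush H a b (suc s) h

  private
    ℓ = suc ρ

  IsCentre : Subset n → Fin n → Set
  IsCentre S w = w ∉ₛ S × (S ∪ ⁅ w ⁆ , w) ∈ M

  isCentre? : ∀ S w → Dec (IsCentre S w)
  isCentre? S w = ¬? (w ∈? S) ×-dec Any.any? (≡-dec _≟ₛ_ Fin._≟_ (S ∪ ⁅ w ⁆ , w)) M

  centresOf : Subset n → Subset n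
  centresOf S = select (isCentre? S)

  isCentre⇒supply : ∀ {S w A} → IsCentre S w → ∣ A ∣ ≡ a → A ⊆ₛ S → w ∉ₛ A × Supply A ⁅ w ⁆
  isCentre⇒supply {A = A} (w∉S , m∈) ∣A∣ A⊆S = w∉S ∘ A⊆S ,
    proj₂ (proj₂ (M⊆ m∈)) A ∣A∣ (λ x∈ → x∈p∪q⁺ (inj₁ (A⊆S x∈))) (w∉S ∘ A⊆S)

  -- The singletons of `suc s` distinct suppliers are disjoint cores, from which a bush around `A`
  -- would be built.
  suppliers≤s : ∀ A U → ∣ A ∣ ≡ a → (∀ {w} → w ∈ₛ U → w ∉ₛ A × Supply A ⁅ w ⁆) → ∣ U ∣ ≤ s
  suppliers≤s A U ∣A∣ supplier = ≮⇒≥ λ s<U → let w = λ i → enum U (inject≤ i s<U) in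
    no-bush (supplies⇒bush A ∣A∣ (λ i → ⁅ w i ⁆) (λ i → ≤-reflexive (∣⁅x⁆∣≡1 (w i)))
      (λ i x∈ → subst (_∉ₛ A) (sym (x∈⁅y⁆⇒x≡y (w i) x∈)) (proj₁ (supplier (enum-∈ U (inject≤ i s<U)))))
      (λ {i} {j} i≢j x∈ x∈′ → i≢j (Fin.inject≤-injective s<U s<U i j
        (enum-injective U (trans (sym (x∈⁅y⁆⇒x≡y (w i) x∈)) (x∈⁅y⁆⇒x≡y (w j) x∈′)))))
      (λ i → proj₂ (supplier (enum-∈ U (inject≤ i s<U)))))

  ∣centresOf∣≤ : ∀ {S} → ∣ S ∣ ≡ ℓ → ∣ centresOf S ∣ ≤ s
  ∣centresOf∣≤ {S} ∣S∣ = suppliers≤s (image f) (centresOf S) (∣image∣ f f-injective)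
    (λ w∈ → isCentre⇒supply (∈-select⁻ (isCentre? S) w∈) (∣image∣ f f-injective) image⊆S)
    where
    a≤ℓ : a ≤ ℓ
    a≤ℓ = m≤n⇒m≤1+n a≤ρ
    f : Fin a → Fin n
    f i = enumAs S ∣S∣ (inject≤ i a≤ℓ)
    f-injective : Injective _≡_ _≡_ f
    f-injective {i} {j} eq = Fin.inject≤-injective a≤ℓ a≤ℓ i j (enumAs-injective S ∣S∣ eq)
    image⊆S : image f ⊆ₛ S
    image⊆S x∈ with ∈-image⁻ f x∈
    ... | i , refl = enumAs-∈ S ∣S∣ _

  -- Every centre over `S` or `S′` is a supplier over the common set `A`, so the union of the two
  -- centre sets has at most `s` elements. Each of them already has `s`.
  centresOf-agree : ∀ {A S S′} → ∣ A ∣ ≡ a → A ⊆ₛ S → A ⊆ₛ S′ → ∣ centresOf S ∣ ≡ s → ∣ centresOf S′ ∣ ≡ s →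
                    centresOf S ≡ centresOf S′
  centresOf-agree {A} {S} {S′} ∣A∣ A⊆S A⊆S′ ∣WS∣ ∣WS′∣ = ⊆-antisym (sub A⊆S A⊆S′ ∣WS′∣) (sub A⊆S′ A⊆S ∣WS∣)
    where
    sub : ∀ {S S′} → A ⊆ₛ S → A ⊆ₛ S′ → ∣ centresOf S′ ∣ ≡ s → centresOf S ⊆ₛ centresOf S′
    sub {S} {S′} A⊆S A⊆S′ ∣WS′∣ {w} w∈ = decidable-stable (w ∈? centresOf S′) λ w∉ →
      <⇒≱ (p⊂q⇒∣p∣<∣q∣ (q⊆p∪q (centresOf S) (centresOf S′) , w , x∈p∪q⁺ (inj₁ w∈) , w∉))
        (≤-trans (suppliers≤s A (centresOf S ∪ centresOf S′) ∣A∣ λ x∈ →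
                    [ (λ x∈S  → isCentre⇒supply (∈-select⁻ (isCentre? S)  x∈S)  ∣A∣ A⊆S)
                    , (λ x∈S′ → isCentre⇒supply (∈-select⁻ (isCentre? S′) x∈S′) ∣A∣ A⊆S′) ]′
                    (x∈p∪q⁻ (centresOf S) (centresOf S′) x∈))
                 (≤-reflexive (sym ∣WS′∣)))

  full? : ∀ S → Dec (∣ centresOf S ∣ ≡ s)
  full? S = ∣ centresOf S ∣ ℕ.≟ s

  sets : List (Subset n)
  sets = subsetsOfSize n ℓ

  ∣sets∣ : ∀ {S} → S ∈ sets → ∣ S ∣ ≡ ℓ
  ∣sets∣ S∈ = proj₂ (∈-filter⁻ (λ p → ∣ p ∣ ℕ.≟ ℓ) {xs = subsets n} S∈)

  ∈-sets : ∀ {S} → ∣ S ∣ ≡ ℓ → S ∈ sets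
  ∈-sets {S} ∣S∣ = ∈-filter⁺ (λ p → ∣ p ∣ ℕ.≟ ℓ) (∈-subsets S) ∣S∣

  deficient : List (Subset n)
  deficient = filter (¬? ∘ full?) sets

  -- A mark `(e , w)` is counted at the set `e` without `w`, where `w` is one of the centres.
  -- Distinct marks have distinct edges, so none is lost.
  length-M≤ : length M ≤ ∑ sets (∣_∣ ∘ centresOf)
  length-M≤ = begin
    length M                                  ≡⟨ length-map proj₁ M ⟨
    length (map proj₁ M)                      ≤⟨ unique⊆⇒length≤ M-unique covered ⟩
    length (concatMap centred sets)           ≡⟨ length-concatMap centred sets ⟩
    ∑ sets (length ∘ centred)
      ≡⟨ ∑-cong sets (λ S → length-tabulate (λ i → S ∪ ⁅ enum (centresOf S) i ⁆)) ⟩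
    ∑ sets (∣_∣ ∘ centresOf)                  ∎
    where
    open ≤-Reasoning
    centred : Subset n → List (Subset n)
    centred S = List.tabulate (λ i → S ∪ ⁅ enum (centresOf S) i ⁆)
    covered : ∀ {e} → e ∈ map proj₁ M → e ∈ concatMap centred sets
    covered e∈ with ∈-map⁻ proj₁ e∈
    ... | (e , w) , m∈ , refl with M⊆ m∈
    ... | e∈H , w∈e , _ = ∈-concatMap⁺ centred (lose (∈-sets ∣S∣) e∈S)
      where
      S = e ∩ ∁ ⁅ w ⁆
      ∣S∣ : ∣ S ∣ ≡ ℓ
      ∣S∣ = suc-injective (trans (cong (_+ ∣ S ∣) (sym (∣⁅x⁆∣≡1 w)))
        (trans (q⊆p⇒∣q∣+∣p∩∁q∣≡∣p∣ {p = e} λ x∈ → subst (_∈ₛ e) (sym (x∈⁅y⁆⇒x≡y w x∈)) w∈e)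
               (All.lookup (uniform H) e∈H)))
      w∈W : w ∈ₛ centresOf S
      w∈W = ∈-select⁺ (isCentre? S)
        ((λ w∈S → proj₂ (∈-minus⁻ {p = e} w∈S) (x∈⁅x⁆ w)) , subst (λ e → (e , w) ∈ M) (sym (minus-∪⁅⁆ w∈e)) m∈)
      e∈S : e ∈ centred S
      e∈S with enum-surjective (centresOf S) w∈W
      ... | i , eq = subst (_∈ centred S) (trans (cong (λ u → S ∪ ⁅ u ⁆) eq) (minus-∪⁅⁆ w∈e))
                       (∈-tabulate⁺ {f = λ i → S ∪ ⁅ enum (centresOf S) i ⁆} i)

  -- A set of size `ℓ` has at most `s` centres, and a deficient one has at least one fewer, so each
  -- deficient set can be added to the count for free.
  length-deficient≤ : length M + length deficient ≤ s * (n C ℓ)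
  length-deficient≤ = begin
    length M + length deficient
      ≤⟨ +-mono-≤ length-M≤ (≤-reflexive (sym (∑-ind (¬? ∘ full?) sets))) ⟩
    ∑ sets (∣_∣ ∘ centresOf) + ∑ sets (λ S → ind (¬? (full? S)))
      ≡⟨ ∑-+ sets (∣_∣ ∘ centresOf) (λ S → ind (¬? (full? S))) ⟨
    ∑ sets (λ S → ∣ centresOf S ∣ + ind (¬? (full? S)))
      ≤⟨ ∑-mono sets (λ {S} S∈ → atMost (full? S) (∣centresOf∣≤ (∣sets∣ S∈))) ⟩
    ∑ sets (λ _ → s)   ≡⟨ ∑-const sets s ⟩
    length sets * s    ≡⟨ *-comm (length sets) s ⟩
    s * length sets    ≡⟨ cong (s *_) (length-subsetsOfSize n ℓ) ⟩
    s * (n C ℓ)        ∎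
    where
    open ≤-Reasoning
    atMost : ∀ {m} (m≟s : Dec (m ≡ s)) → m ≤ s → m + ind (¬? m≟s) ≤ s
    atMost (yes _)  m≤s = ≤-trans (≤-reflexive (+-identityʳ _)) m≤s
    atMost (no m≢s) m≤s = ≤-trans (≤-reflexive (+-comm _ 1)) (≤∧≢⇒< m≤s m≢s)

  support : Vec (Fin n) ℓ → Subset n
  support t = image (Vec.lookup t)

  -- Ordered tuples replace `ℓ`-sets so that one coordinate can be changed at a time. A tuple with a
  -- repetition does not represent an `ℓ`-set and is discarded as well.
  Bad : Vec (Fin n) ℓ → Set
  Bad t = repetitions t ≢ 0 ⊎ ∣ centresOf (support t) ∣ ≢ s

  bad? : ∀ t → Dec (Bad t)
  bad? t = ¬? (repetitions t ℕ.≟ 0) ⊎-dec ¬? (full? (support t))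

  ¬Bad⇒injective : ∀ t → ¬ Bad t → Injective _≡_ _≡_ (Vec.lookup t)
  ¬Bad⇒injective t good = repetitions≡0⇒injective t (decidable-stable (repetitions t ℕ.≟ 0) (good ∘ inj₁))

  ¬Bad⇒full : ∀ t → ¬ Bad t → ∣ centresOf (support t) ∣ ≡ s
  ¬Bad⇒full t good = decidable-stable (full? (support t)) (good ∘ inj₂)

  -- The tuples share `ρ` coordinates, and `a ≤ ρ`, so both supports contain a common `a`-set.
  adjacent-agree : ∀ t t′ → Adjacent t t′ → ¬ Bad t → ¬ Bad t′ → centresOf (support t) ≡ centresOf (support t′)
  adjacent-agree t t′ (i , same) good good′ =
    centresOf-agree (∣image∣ f f-injective) image⊆ image⊆′ (¬Bad⇒full t good) (¬Bad⇒full t′ good′)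
    where
    at : Fin a → Fin ℓ
    at j = punchIn i (inject≤ j a≤ρ)
    f : Fin a → Fin n
    f = Vec.lookup t ∘ at
    f-injective : Injective _≡_ _≡_ f
    f-injective {j} {j′} eq =
      Fin.inject≤-injective a≤ρ a≤ρ j j′ (Fin.punchIn-injective i _ _ (¬Bad⇒injective t good eq))
    image⊆ : image f ⊆ₛ support t
    image⊆ x∈ with ∈-image⁻ f x∈
    ... | j , refl = ∈-image⁺ (Vec.lookup t) (at j)
    image⊆′ : image f ⊆ₛ support t′
    image⊆′ x∈ with ∈-image⁻ f x∈
    ... | j , refl = subst (_∈ₛ support t′) (sym (same (at j) (≢-sym (Fin.punchInᵢ≢i i _))))
                       (∈-image⁺ (Vec.lookup t′) (at j))

  bad≤ : ∀ t → ind (bad? t) ≤ repetitions t + ∑ deficient (λ S → within S t)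
  bad≤ t = ind≤ (bad? t) λ bad → covers bad (repetitions t ℕ.≟ 0)
    where
    covers : Bad t → Dec (repetitions t ≡ 0) → 1 ≤ repetitions t + ∑ deficient (λ S → within S t)
    covers _            (no  ≢0) = ≤-trans (n≢0⇒n>0 ≢0) (m≤m+n _ _)
    covers (inj₁ ≢0)    (yes ≡0) = contradiction ≡0 ≢0
    covers (inj₂ ≢full) (yes ≡0) = ≤-trans (≤-trans (within≥1 (support t) t (∈-image⁺ (Vec.lookup t)))
      (term≤∑ deficient (λ S → within S t)
        (∈-filter⁺ (¬? ∘ full?) (∈-sets (∣image∣ (Vec.lookup t) (repetitions≡0⇒injective t ≡0))) ≢full)))
      (m≤n+m _ (repetitions t))

  -- A bad tuple has a repetition or has all its entries in a deficient set, and each deficient set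
  -- accounts for at most `ℓ ^ ℓ` tuples.
  ∑-bad≤ : ∀ d → length deficient ≤ d * n ^ ρ → ∑ (tuples n ℓ) (ind ∘ bad?) ≤ (ℓ * ℓ + d * ℓ ^ ℓ) * n ^ ρ
  ∑-bad≤ d deficient≤ = begin
    ∑ (tuples n ℓ) (ind ∘ bad?)
      ≤⟨ ∑-mono (tuples n ℓ) (λ {t} _ → bad≤ t) ⟩
    ∑ (tuples n ℓ) (λ t → repetitions t + ∑ deficient (λ S → within S t))
      ≡⟨ ∑-+ (tuples n ℓ) repetitions (λ t → ∑ deficient (λ S → within S t)) ⟩
    ∑ (tuples n ℓ) repetitions + ∑ (tuples n ℓ) (λ t → ∑ deficient (λ S → within S t))
      ≡⟨ cong (∑ (tuples n ℓ) repetitions +_) (∑-swap (tuples n ℓ) deficient (λ t S → within S t)) ⟩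
    ∑ (tuples n ℓ) repetitions + ∑ deficient (λ S → ∑ (tuples n ℓ) (within S))
      ≤⟨ +-mono-≤ repetitions≤ (∑-mono deficient within≤) ⟩
    ℓ * ℓ * n ^ ρ + ∑ deficient (λ _ → ℓ ^ ℓ)
      ≡⟨ cong (ℓ * ℓ * n ^ ρ +_) (∑-const deficient (ℓ ^ ℓ)) ⟩
    ℓ * ℓ * n ^ ρ + length deficient * ℓ ^ ℓ
      ≤⟨ +-monoʳ-≤ (ℓ * ℓ * n ^ ρ) (*-monoˡ-≤ (ℓ ^ ℓ) deficient≤) ⟩
    ℓ * ℓ * n ^ ρ + d * n ^ ρ * ℓ ^ ℓ
      ≡⟨ arith (ℓ * ℓ) (n ^ ρ) d (ℓ ^ ℓ) ⟩
    (ℓ * ℓ + d * ℓ ^ ℓ) * n ^ ρ ∎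
    where
    open ≤-Reasoning
    open +-*-Solver
    arith : ∀ c p d q → c * p + d * p * q ≡ (c + d * q) * p
    arith = solve 4 (λ c p d q → c :* p :+ d :* p :* q := (c :+ d :* q) :* p) refl
    arith′ : ∀ c n p → c * (n * p) ≡ n * (c * p)
    arith′ = solve 3 (λ c n p → c :* (n :* p) := n :* (c :* p)) refl
    repetitions≤ : ∑ (tuples n ℓ) repetitions ≤ ℓ * ℓ * n ^ ρ
    -- Cancelling the factor `n` carried by `∑-repetitions` lowers the exponent from `ℓ` to `ρ`.
    repetitions≤ = *-cancelˡ-≤ n {{ℕ.>-nonZero 0<n}}
      (≤-trans (∑-repetitions {n} ℓ) (≤-reflexive (arith′ (ℓ * ℓ) n (n ^ ρ))))
    within≤ : ∀ {S} → S ∈ deficient → ∑ (tuples n ℓ) (within S) ≤ ℓ ^ ℓ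
    within≤ {S} S∈ = ≤-trans (∑-within ℓ S)
      (≤-reflexive (cong (_^ ℓ) (∣sets∣ (proj₁ (∈-filter⁻ (¬? ∘ full?) {xs = sets} S∈)))))

  -- Each `S` whose centre set is `W` gives an edge through `w`, namely `S` together with `w`, and
  -- distinct `S` give distinct edges. Every other `ℓ`-set is the support of an exceptional tuple,
  -- for instance of its increasing enumeration.
  degree≥ : ∀ {W w} → w ∈ₛ W → n C ℓ ≤ degree H w + ∑ (tuples n ℓ) (ind ∘ exceptional? _≟ₛ_ bad? (centresOf ∘ support) W)
  degree≥ {W} {w} w∈W = begin
    n C ℓ                            ≡⟨ length-subsetsOfSize n ℓ ⟨
    length sets                      ≡⟨ length-filter-¬ agree? sets ⟨
    length agreeing + length others  ≤⟨ +-mono-≤ agreeing≤ others≤ ⟩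
    degree H w + ∑ (tuples n ℓ) (ind ∘ exc?) ∎
    where
    open ≤-Reasoning
    exc? = exceptional? _≟ₛ_ bad? (centresOf ∘ support) W
    agree? : ∀ S → Dec (centresOf S ≡ W)
    agree? S = centresOf S ≟ₛ W
    agreeing = filter agree? sets
    others = filter (¬? ∘ agree?) sets
    sets-unique : Unique sets
    sets-unique = Unique.filter⁺ (λ p → ∣ p ∣ ℕ.≟ ℓ) (subsets-unique n)
    agreeing≤ : length agreeing ≤ degree H w
    agreeing≤ = ≤-trans (unique⊆⇒length≤ (Unique.filter⁺ agree? sets-unique) reached)
                        (≤-reflexive (length-map (_∩ ∁ ⁅ w ⁆) (filter (w ∈?_) (edges H))))
      where
      reached : ∀ {S} → S ∈ agreeing → S ∈ map (_∩ ∁ ⁅ w ⁆) (filter (w ∈?_) (edges H))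
      reached {S} S∈ with ∈-select⁻ (isCentre? S) (subst (w ∈ₛ_) (sym (proj₂ (∈-filter⁻ agree? {xs = sets} S∈))) w∈W)
      ... | w∉S , m∈ = subst (_∈ map (_∩ ∁ ⁅ w ⁆) (filter (w ∈?_) (edges H))) (∪⁅⁆-minus w∉S)
        (∈-map⁺ (_∩ ∁ ⁅ w ⁆) (∈-filter⁺ (w ∈?_) (proj₁ (M⊆ m∈)) (proj₁ (proj₂ (M⊆ m∈)))))
    others≤ : length others ≤ ∑ (tuples n ℓ) (ind ∘ exc?)
    others≤ = begin
      length others
        ≤⟨ unique⊆⇒length≤ (Unique.filter⁺ (¬? ∘ agree?) sets-unique) reached ⟩
      length (map support (filter exc? (tuples n ℓ)))    ≡⟨ length-map support (filter exc? (tuples n ℓ)) ⟩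
      length (filter exc? (tuples n ℓ))                  ≡⟨ ∑-ind exc? (tuples n ℓ) ⟨
      ∑ (tuples n ℓ) (ind ∘ exc?)                        ∎
      where
      reached : ∀ {S} → S ∈ others → S ∈ map support (filter exc? (tuples n ℓ))
      reached {S} S∈ = subst (_∈ map support (filter exc? (tuples n ℓ))) support≡
        (∈-map⁺ support (∈-filter⁺ exc? (∈-words ∈-allFin t)
          (inj₂ λ eq → proj₂ S∈′ (trans (cong centresOf (sym support≡)) eq))))
        where
        S∈′ = ∈-filter⁻ (¬? ∘ agree?) {xs = sets} S∈
        f : Fin ℓ → Fin n
        f = enumAs S (∣sets∣ (proj₁ S∈′))
        t = Vec.tabulate f
        support≡ : support t ≡ S
        support≡ = ⊆-antisym to from
          where
          to : support t ⊆ₛ S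
          to x∈ with ∈-image⁻ (Vec.lookup t) x∈
          ... | i , refl = subst (_∈ₛ S) (sym (Vec.lookup∘tabulate f i)) (enumAs-∈ S (∣sets∣ (proj₁ S∈′)) i)
          from : S ⊆ₛ support t
          from x∈ with enumAs-surjective S (∣sets∣ (proj₁ S∈′)) x∈
          ... | i , refl = subst (_∈ₛ support t) (Vec.lookup∘tabulate f i) (∈-image⁺ (Vec.lookup t) i)

  concentration : ∀ c → suc ℓ * ∑ (tuples n ℓ) (ind ∘ bad?) ≤ c * n ^ ρ → c < n →
                  Σ (Fin s → Fin n) λ f → Injective _≡_ _≡_ f × (∀ i → n C ℓ ≤ degree H (f i) + c * n ^ ρ)
  concentration c bad≤c c<n =
    let W , exceptions = majority _≟ₛ_ 0<n ℓ bad? (centresOf ∘ support) (λ {t} {t′} → adjacent-agree t t′)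
    in fromMajority W (≤-trans exceptions bad≤c)
    where
    open ≤-Reasoning
    fromMajority : ∀ W → ∑ (tuples n ℓ) (ind ∘ exceptional? _≟ₛ_ bad? (centresOf ∘ support) W) ≤ c * n ^ ρ →
                   Σ (Fin s → Fin n) λ f → Injective _≡_ _≡_ f × (∀ i → n C ℓ ≤ degree H (f i) + c * n ^ ρ)
    fromMajority W exceptions≤ = enumAs W ∣W∣≡s , enumAs-injective W ∣W∣≡s ,
      λ i → ≤-trans (degree≥ (enumAs-∈ W ∣W∣≡s i)) (+-monoʳ-≤ (degree H (enumAs W ∣W∣≡s i)) exceptions≤)
      where
      exc? = exceptional? _≟ₛ_ bad? (centresOf ∘ support) W
      -- Since `c < n`, there are fewer exceptional tuples than tuples. One typical tuple suffices
      -- to see that `W` has exactly `s` elements.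
      typical : ∃ λ t → t ∈ tuples n ℓ × ¬ (Bad t ⊎ centresOf (support t) ≢ W)
      typical = ∃-filter-¬ exc? (tuples n ℓ) (begin-strict
        length (filter exc? (tuples n ℓ))   ≡⟨ ∑-ind exc? (tuples n ℓ) ⟨
        ∑ (tuples n ℓ) (ind ∘ exc?)         ≤⟨ exceptions≤ ⟩
        c * n ^ ρ                           <⟨ *-monoˡ-< (n ^ ρ) {{m^n≢0 n ρ {{ℕ.>-nonZero 0<n}}}} c<n ⟩
        n ^ ℓ                               ≡⟨ length-tuples n ℓ ⟨
        length (tuples n ℓ)                 ∎)
      ∣W∣≡s : ∣ W ∣ ≡ s
      ∣W∣≡s = let t , _ , ¬exc = typical in
        trans (cong ∣_∣ (sym (decidable-stable (centresOf (support t) ≟ₛ W) (¬exc ∘ inj₂)))) (¬Bad⇒full t (¬exc ∘ inj₁))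

-- The constants

theorem5 : (a b s h : ℕ) → s ≥ 2 → a ≥ 2 → b ≥ 2 → h ≥ 1 → a + b ≥ 5 →
    (C₀ : ℕ) → C₀ ≥ 1 →
    Σ ℕ λ n₀ → Σ ℕ λ C₁ → n₀ ≥ 1 × C₁ ≥ 1 ×
    ((n : ℕ) → n₀ < n → (H : Hypergraph n (a + b)) →
    ¬ ContainsBush a b s h H →
    (s ∸ 1) * (n C (a + b ∸ 1)) < size H + C₀ * n ^ (a + b ∸ 2) →
    Σ (Fin (s ∸ 1) → Fin n) λ f → Injective _≡_ _≡_ f ×
    ((k : Fin (s ∸ 1)) → n C (a + b ∸ 1) ≤ degree H (f k) + C₁ * n ^ (a + b ∸ 2)))
theorem5 (suc zero) _ _ _ _ (s≤s ())
-- Matching on `a` and `s` makes `a + b ∸ 1`, `a + b ∸ 2` and `s ∸ 1` compute to `suc ρ`, `ρ` and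
-- the new `s`.
theorem5 (suc (suc a′)) b (suc s) h _ 2≤a 2≤b _ 5≤r C₀ _ =
  -- The same constant serves twice: as C₁ it bounds the exceptional tuples, and as n₀ it ensures
  -- that a typical tuple exists.
  c , c , exceptionBound≥1 ρ d , exceptionBound≥1 ρ d , concentrated
  where
  ρ = a′ + b
  L = reserve (2 + a′) b (suc s) h
  -- Deficient sets come from two sources: edges left without a centre (`loss`) and the shortfall
  -- allowed in the size of the hypergraph (`C₀`).
  d = loss (2 + ρ) L + C₀
  c = exceptionBound (suc ρ) d
  -- Equivalent to `2 ≤ b`: an `a`-set still fits after one coordinate of an `(r - 1)`-tuple is
  -- dropped.
  a≤ρ : 2 + a′ ≤ ρ
  a≤ρ = ≤-trans (≤-reflexive (+-comm 2 a′)) (+-monoʳ-≤ a′ 2≤b)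
  deficient≤ : ∀ {m d t e} (l : ℕ) {p} → m + d ≤ t → t < e + C₀ * p → e ≤ m + l * p → d ≤ (l + C₀) * p
  deficient≤ {m} {d} {t} {e} l {p} md≤t t< e≤ = +-cancelˡ-≤ m d ((l + C₀) * p) (begin
    m + d                   ≤⟨ md≤t ⟩
    t                       ≤⟨ <⇒≤ t< ⟩
    e + C₀ * p              ≤⟨ +-monoˡ-≤ (C₀ * p) e≤ ⟩
    m + l * p + C₀ * p      ≡⟨ trans (+-assoc m (l * p) (C₀ * p)) (cong (m +_) (sym (*-distribʳ-+ p l C₀))) ⟩
    m + (l + C₀) * p        ∎)
    where open ≤-Reasoning
  concentrated : ∀ n → c < n → (H : Hypergraph n (2 + ρ)) → ¬ ContainsBush (2 + a′) b (suc s) h H →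
                 s * (n C suc ρ) < size H + C₀ * n ^ ρ →
                 Σ (Fin s → Fin n) λ f → Injective _≡_ _≡_ f × (∀ k → n C suc ρ ≤ degree H (f k) + c * n ^ ρ)
  concentrated n c<n H no-bush large = concentration c bad≤ c<n
    where
    open Extraction H (2 + a′) b (suc s) h refl 2≤a 2≤b 5≤r no-bush
    all : Centring (edges H)
    all = centring (size H) (edges H) ≤-refl (unique H) id
    open Concentration (≤-trans (s≤s z≤n) c<n) H (2 + a′) b s h a≤ρ no-bush
           (Centring.marks all) (Centring.marks-unique all) (Centring.marked all) hiding (bad≤)
    bad≤ : suc (suc ρ) * ∑ (tuples n (suc ρ)) (ind ∘ bad?) ≤ c * n ^ ρ
    bad≤ = ≤-trans
      (*-monoʳ-≤ (suc (suc ρ)) (∑-bad≤ d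
        (deficient≤ (loss (2 + ρ) L) length-deficient≤ large (Centring.length≤ all))))
      (≤-reflexive (exceptionBound-* (suc ρ) d (n ^ ρ)))
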